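{- Let $p>5$ be a prime such that $-1$ is a quadratic residue modulo $p$ and $2$ and $3$ are both quadratic non-residues modulo $p$. Then the path system $\mathcal{P}_p$ on the Paley graph $G_p$ is irreducible and non-metrizable.
   Context: For a prime $p$ with $-1$ a quadratic residue (i.e. $p\equiv 1\pmod 4$), let $R$ and $N$ denote the sets of nonzero quadratic residues and quadratic non-residues in $\mathbb{F}_p$. The Paley graph $G_p$ has vertex set $\mathbb{F}_p$, with $a,b$ adjacent iff $a-b\in R$ (this relation is symmetric since $-1\in R$). A path system $\mathcal{P}$ in a graph $G=(V,E)$ is a collection of simple paths in $G$ such that for every pair of distinct vertices $u,v$ there is exactly one path $P_{u,v}\in\mathcal{P}$ connecting $u$ and $v$. $\mathcal{P}$ is metrizable if there exists $w:E\to(0,\infty)$ such that for all $u,v$, $w(P_{u,v})\le w(Q)$ for every $u$–$v$ path $Q$ in $G$ (where $w$ of a path is the sum of its edge weights). A partition $V=A\sqcup B$ with $A,B\neq\emptyset$ is a reduction of $\mathcal{P}$ if for all $u,v\in A$ all vertices of $P_{u,v}$ lie in $A$, and for all $u,v\in B$ all vertices of $P_{u,v}$ lie in $B$; $\mathcal{P}$ is irreducible if it has no reduction. The path system $\mathcal{P}_p$ on $G_p$ (assuming $2,3\in N$) is defined for $a\neq b\in\mathbb{F}_p$ by: if $b-a\in R$, then $P_{a,b}=(a,b)$; if $b-a=3$, then $P_{a,b}=(a,a+1,a+2,b)$ (and $P_{b,a}$ is the same path); if $b-a\in N$ and $b-a\neq\pm3$, then $P_{a,b}=(a,\tfrac{a+b}{2},b)$.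 -}

module Defs where

open import Algebra.Bundles using (CommutativeMonoid; CommutativeRing)
open import Algebra.Structures using (IsCommutativeRing)
import Algebra.Properties.Ring as RingProperties
import Algebra.Solver.Ring.NaturalCoefficients.Default as SemiringSolver
open import Data.Empty using (⊥; ⊥-elim)
open import Data.Fin.Base using (Fin; toℕ; combine; remQuot)
import Data.Fin.Base as Fin
import Data.Fin.Properties as Fin
open import Data.List.Base using (List; []; _∷_; reverse)
open import Data.List.Relation.Unary.All using (All; []; _∷_)
open import Data.List.Relation.Unary.AllPairs using ([]; _∷_)
open import Data.List.Relation.Unary.Unique.Propositional using (Unique)
open import Data.Nat.Base using (ℕ; zero; suc; NonZero; z≤n; s≤s)
import Data.Nat.Base as ℕ
import Data.Nat.Properties as ℕ
open import Data.Nat.Coprimality using (prime⇒coprime; coprime-Bézout)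
open import Data.Nat.DivMod using (_%_; _mod_; m%n<n; m<n⇒m%n≡m; n%n≡0; %-distribˡ-+; %-distribˡ-*)
open import Data.Nat.GCD using (module Bézout)
open import Data.Nat.Primality using (Prime; ¬prime[1])
open import Data.Product.Base using (Σ; ∃; _×_; _,_; proj₁; proj₂)
open import Data.Product using (∃!)
open import Data.Rational.Base using (ℚ; 0ℚ; ½)
import Data.Rational.Base as ℚ
import Data.Rational.Properties as ℚ
open import Data.Sum.Base using (_⊎_)
open import Function.Base using (_∘_)
open import Level using (0ℓ)
open import Relation.Binary.Core using (Rel)
open import Relation.Binary.Definitions using (Symmetric; Irreflexive; tri<; tri≈; tri>)
open import Relation.Binary.PropositionalEquality
open import Relation.Nullary using (¬_; Dec; yes; no)
open import Relation.Unary using (Pred; _∈_)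

-- Real numbers, as Cauchy sequences of rationals with setoid equality _≃_

module Real where

  record ℝ : Set where
    constructor mkℝ
    field
      seq    : ℕ → ℚ
      cauchy : ∀ ε → 0ℚ ℚ.< ε →
               ∃ λ N → ∀ m n → N ℕ.≤ m → N ℕ.≤ n → ℚ.∣ seq m ℚ.- seq n ∣ ℚ.< ε

  open ℝ public

  infix  4 _≤_ _<_ _≃_
  infixl 6 _+_

  _≤_ : Rel ℝ 0ℓ
  x ≤ y = ∀ ε → 0ℚ ℚ.< ε → ∃ λ N → ∀ n → N ℕ.≤ n → seq x n ℚ.≤ seq y n ℚ.+ ε

  _<_ : Rel ℝ 0ℓ
  x < y = ∃ λ ε → 0ℚ ℚ.< ε × ∃ λ N → ∀ n → N ℕ.≤ n → seq x n ℚ.+ ε ℚ.≤ seq y n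

  _≃_ : Rel ℝ 0ℓ
  x ≃ y = x ≤ y × y ≤ x

  0ℝ : ℝ
  0ℝ = mkℝ (λ _ → 0ℚ) (λ ε 0<ε → 0 , λ _ _ _ _ → 0<ε)

  private
    half>0 : ∀ {ε} → 0ℚ ℚ.< ε → 0ℚ ℚ.< ½ ℚ.* ε
    half>0 {ε} 0<ε = subst (ℚ._< ½ ℚ.* ε) (ℚ.*-zeroʳ ½) (ℚ.*-monoʳ-<-pos ½ 0<ε)

    half+half : ∀ ε → ½ ℚ.* ε ℚ.+ ½ ℚ.* ε ≡ ε
    half+half ε = trans (sym (ℚ.*-distribʳ-+ ε ½ ½)) (ℚ.*-identityˡ ε)

    regroup : ∀ a b c d → (a ℚ.+ b) ℚ.- (c ℚ.+ d) ≡ (a ℚ.- c) ℚ.+ (b ℚ.- d)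
    regroup a b c d = trans (cong ((a ℚ.+ b) ℚ.+_) (ℚ.neg-distrib-+ c d))
      (interchange a b (ℚ.- c) (ℚ.- d))
      where
      open import Algebra.Properties.CommutativeSemigroup
        (CommutativeMonoid.commutativeSemigroup ℚ.+-0-commutativeMonoid) using (interchange)

  _+_ : ℝ → ℝ → ℝ
  seq    (x + y) n = seq x n ℚ.+ seq y n
  cauchy (x + y) ε 0<ε
    with M , x-close ← cauchy x (½ ℚ.* ε) (half>0 0<ε)
       | N , y-close ← cauchy y (½ ℚ.* ε) (half>0 0<ε)
       = M ℕ.⊔ N , λ m n ≤m ≤n →
         let x<ε = x-close m n (ℕ.m⊔n≤o⇒m≤o M N ≤m) (ℕ.m⊔n≤o⇒m≤o M N ≤n)
             y<ε = y-close m n (ℕ.m⊔n≤o⇒n≤o M N ≤m) (ℕ.m⊔n≤o⇒n≤o M N ≤n)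
             dx  = seq x m ℚ.- seq x n
             dy  = seq y m ℚ.- seq y n
         in subst₂ ℚ._<_
              (cong ℚ.∣_∣ (sym (regroup (seq x m) (seq y m) (seq x n) (seq y n))))
              (half+half ε)
              (ℚ.≤-<-trans (ℚ.∣p+q∣≤∣p∣+∣q∣ dx dy) (ℚ.+-mono-< x<ε y<ε))

open Real using (ℝ; 0ℝ)

record Graph : Set₁ where
  infix 4 _~_
  field
    V        : Set
    _~_      : Rel V 0ℓ
    ~-sym    : Symmetric _~_
    ~-irrefl : Irreflexive _≡_ _~_

module _ (G : Graph) where
  open Graph G

  -- A walk is given by the list of its vertices, both endpoints included.
  data IsWalk : V → V → List V → Set where
    [-] : ∀ {u} → IsWalk u u (u ∷ [])
    _∷_ : ∀ {u v w xs} → u ~ v → IsWalk v w xs → IsWalk u w (u ∷ xs)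

  IsPath : V → V → List V → Set
  IsPath u v xs = IsWalk u v xs × Unique xs

  -- Paths are undirected: the collection contains the vertex sequence of each
  -- of its paths read in both directions, 𝒫 u v holding of those that run from
  -- u to v. With `reversed`, `exactly-one` thus says that there is exactly one
  -- path for each unordered pair of distinct vertices.
  record PathSystem : Set₁ where
    field
      𝒫           : V → V → Pred (List V) 0ℓ
      paths       : ∀ {u v xs} → 𝒫 u v xs → IsPath u v xs
      reversed    : ∀ {u v xs} → 𝒫 u v xs → 𝒫 v u (reverse xs)
      exactly-one : ∀ {u v} → u ≢ v → ∃! _≡_ (𝒫 u v)

  -- A positive weight function on the (undirected) edges; the values of w on
  -- non-adjacent pairs are irrelevant.
  record Weight : Set where
    field
      w     : V → V → ℝ
      w-sym : ∀ {u v} → u ~ v → w u v Real.≃ w v u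
      w-pos : ∀ {u v} → u ~ v → 0ℝ Real.< w u v

    total : List V → ℝ
    total []           = 0ℝ
    total (x ∷ [])     = 0ℝ
    total (x ∷ y ∷ xs) = w x y Real.+ total (y ∷ xs)

module _ {G : Graph} (S : PathSystem G) where
  open Graph G
  open PathSystem S

  Metrizable : Set
  Metrizable = Σ (Weight G) λ W → let open Weight W in
    ∀ {u v xs ys} → 𝒫 u v xs → IsPath G u v ys → total xs Real.≤ total ys

  record Reduction : Set₁ where
    field
      A B        : Pred V 0ℓ
      cover      : ∀ v → v ∈ A ⊎ v ∈ B
      disjoint   : ∀ {v} → v ∈ A → v ∈ B → ⊥
      A-nonempty : ∃ A
      B-nonempty : ∃ B
      A-closed   : ∀ {u v xs} → u ∈ A → v ∈ A → 𝒫 u v xs → All A xs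
      B-closed   : ∀ {u v xs} → u ∈ B → v ∈ B → 𝒫 u v xs → All B xs

  Irreducible : Set₁
  Irreducible = ¬ Reduction

-- ℤ/pℤ, a field when p is prime

module Residues (p : ℕ) .{{_ : NonZero p}} where

  𝔽 : Set
  𝔽 = Fin p

  infixl 6 _+_ _-_
  infixl 7 _*_
  infix  8 -_

  -- Opaque so that unification does not unfold to natural-number arithmetic.
  opaque
    ⟦_⟧ : ℕ → 𝔽
    ⟦ n ⟧ = n mod p

    _+_ _*_ : 𝔽 → 𝔽 → 𝔽
    x + y = ⟦ toℕ x ℕ.+ toℕ y ⟧
    x * y = ⟦ toℕ x ℕ.* toℕ y ⟧

    -_ : 𝔽 → 𝔽
    - x = ⟦ p ℕ.∸ toℕ x ⟧

  _-_ : 𝔽 → 𝔽 → 𝔽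
  x - y = x + (- y)

  QR : Pred 𝔽 0ℓ
  QR x = x ≢ ⟦ 0 ⟧ × ∃ λ y → y * y ≡ x

  QNR : Pred 𝔽 0ℓ
  QNR x = x ≢ ⟦ 0 ⟧ × ¬ ∃ λ y → y * y ≡ x

  opaque
    unfolding ⟦_⟧

    toℕ-⟦⟧ : ∀ n → toℕ ⟦ n ⟧ ≡ n % p
    toℕ-⟦⟧ n = Fin.toℕ-fromℕ< (m%n<n n p)

    ⟦⟧-cong : ∀ {m n} → m % p ≡ n % p → ⟦ m ⟧ ≡ ⟦ n ⟧
    ⟦⟧-cong {m} {n} eq = Fin.toℕ-injective (trans (toℕ-⟦⟧ m) (trans eq (sym (toℕ-⟦⟧ n))))

    ⟦toℕ⟧ : ∀ x → ⟦ toℕ x ⟧ ≡ x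
    ⟦toℕ⟧ x = Fin.toℕ-injective (trans (toℕ-⟦⟧ (toℕ x)) (m<n⇒m%n≡m (Fin.toℕ<n x)))

    ⟦+⟧ : ∀ m n → ⟦ m ⟧ + ⟦ n ⟧ ≡ ⟦ m ℕ.+ n ⟧
    ⟦+⟧ m n = ⟦⟧-cong (trans (cong₂ (λ a b → (a ℕ.+ b) % p) (toℕ-⟦⟧ m) (toℕ-⟦⟧ n))
                             (sym (%-distribˡ-+ m n p)))

    ⟦*⟧ : ∀ m n → ⟦ m ⟧ * ⟦ n ⟧ ≡ ⟦ m ℕ.* n ⟧
    ⟦*⟧ m n = ⟦⟧-cong (trans (cong₂ (λ a b → (a ℕ.* b) % p) (toℕ-⟦⟧ m) (toℕ-⟦⟧ n))
                             (sym (%-distribˡ-* m n p)))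

    ⟦-⟧ : ∀ x → - x ≡ ⟦ p ℕ.∸ toℕ x ⟧
    ⟦-⟧ x = refl

  ⟦p⟧ : ⟦ p ⟧ ≡ ⟦ 0 ⟧
  ⟦p⟧ = ⟦⟧-cong (trans (n%n≡0 p) (sym (m<n⇒m%n≡m (ℕ.>-nonZero⁻¹ p))))

  ⟦⟧≢0 : ∀ {n} .{{_ : NonZero n}} → n ℕ.< p → ⟦ n ⟧ ≢ ⟦ 0 ⟧
  ⟦⟧≢0 {n} n<p eq = ℕ.≢-nonZero⁻¹ n (begin
    n          ≡⟨ sym (m<n⇒m%n≡m n<p) ⟩
    n % p      ≡⟨ sym (toℕ-⟦⟧ n) ⟩
    toℕ ⟦ n ⟧  ≡⟨ cong toℕ eq ⟩
    toℕ ⟦ 0 ⟧  ≡⟨ toℕ-⟦⟧ 0 ⟩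
    0 % p      ≡⟨ m<n⇒m%n≡m (ℕ.>-nonZero⁻¹ p) ⟩
    0          ∎)
    where open ≡-Reasoning

  private
    onto : (P : 𝔽 → 𝔽 → 𝔽 → Set) → (∀ a b c → P ⟦ a ⟧ ⟦ b ⟧ ⟦ c ⟧) → ∀ x y z → P x y z
    onto P h x y z = subst (λ t → P t y z) (⟦toℕ⟧ x)
      (subst (λ t → P ⟦ toℕ x ⟧ t z) (⟦toℕ⟧ y)
        (subst (λ t → P ⟦ toℕ x ⟧ ⟦ toℕ y ⟧ t) (⟦toℕ⟧ z) (h (toℕ x) (toℕ y) (toℕ z))))

    +-assoc′ : ∀ x y z → (x + y) + z ≡ x + (y + z)
    +-assoc′ = onto (λ x y z → (x + y) + z ≡ x + (y + z)) λ a b c → begin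
      (⟦ a ⟧ + ⟦ b ⟧) + ⟦ c ⟧  ≡⟨ cong (_+ ⟦ c ⟧) (⟦+⟧ a b) ⟩
      ⟦ a ℕ.+ b ⟧ + ⟦ c ⟧      ≡⟨ ⟦+⟧ (a ℕ.+ b) c ⟩
      ⟦ a ℕ.+ b ℕ.+ c ⟧        ≡⟨ cong ⟦_⟧ (ℕ.+-assoc a b c) ⟩
      ⟦ a ℕ.+ (b ℕ.+ c) ⟧      ≡⟨ ⟦+⟧ a (b ℕ.+ c) ⟨
      ⟦ a ⟧ + ⟦ b ℕ.+ c ⟧      ≡⟨ cong (⟦ a ⟧ +_) (⟦+⟧ b c) ⟨
      ⟦ a ⟧ + (⟦ b ⟧ + ⟦ c ⟧)  ∎
      where open ≡-Reasoning

    *-assoc′ : ∀ x y z → (x * y) * z ≡ x * (y * z)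
    *-assoc′ = onto (λ x y z → (x * y) * z ≡ x * (y * z)) λ a b c → begin
      (⟦ a ⟧ * ⟦ b ⟧) * ⟦ c ⟧  ≡⟨ cong (_* ⟦ c ⟧) (⟦*⟧ a b) ⟩
      ⟦ a ℕ.* b ⟧ * ⟦ c ⟧      ≡⟨ ⟦*⟧ (a ℕ.* b) c ⟩
      ⟦ a ℕ.* b ℕ.* c ⟧        ≡⟨ cong ⟦_⟧ (ℕ.*-assoc a b c) ⟩
      ⟦ a ℕ.* (b ℕ.* c) ⟧      ≡⟨ ⟦*⟧ a (b ℕ.* c) ⟨
      ⟦ a ⟧ * ⟦ b ℕ.* c ⟧      ≡⟨ cong (⟦ a ⟧ *_) (⟦*⟧ b c) ⟨
      ⟦ a ⟧ * (⟦ b ⟧ * ⟦ c ⟧)  ∎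
      where open ≡-Reasoning

    +-comm′ : ∀ x y → x + y ≡ y + x
    +-comm′ x y = onto (λ x y _ → x + y ≡ y + x)
      (λ a b _ → trans (⟦+⟧ a b) (trans (cong ⟦_⟧ (ℕ.+-comm a b)) (sym (⟦+⟧ b a)))) x y x

    *-comm′ : ∀ x y → x * y ≡ y * x
    *-comm′ x y = onto (λ x y _ → x * y ≡ y * x)
      (λ a b _ → trans (⟦*⟧ a b) (trans (cong ⟦_⟧ (ℕ.*-comm a b)) (sym (⟦*⟧ b a)))) x y x

    +-identityˡ′ : ∀ x → ⟦ 0 ⟧ + x ≡ x
    +-identityˡ′ x = onto (λ x _ _ → ⟦ 0 ⟧ + x ≡ x) (λ a _ _ → ⟦+⟧ 0 a) x x x

    *-identityˡ′ : ∀ x → ⟦ 1 ⟧ * x ≡ x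
    *-identityˡ′ x = onto (λ x _ _ → ⟦ 1 ⟧ * x ≡ x)
      (λ a _ _ → trans (⟦*⟧ 1 a) (cong ⟦_⟧ (ℕ.*-identityˡ a))) x x x

    +-inverseʳ′ : ∀ x → x + (- x) ≡ ⟦ 0 ⟧
    +-inverseʳ′ x = begin
      x + (- x)                    ≡⟨ cong₂ _+_ (sym (⟦toℕ⟧ x)) (⟦-⟧ x) ⟩
      ⟦ toℕ x ⟧ + ⟦ p ℕ.∸ toℕ x ⟧  ≡⟨ ⟦+⟧ (toℕ x) (p ℕ.∸ toℕ x) ⟩
      ⟦ toℕ x ℕ.+ (p ℕ.∸ toℕ x) ⟧  ≡⟨ cong ⟦_⟧ (ℕ.m+[n∸m]≡n (ℕ.<⇒≤ (Fin.toℕ<n x))) ⟩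
      ⟦ p ⟧                        ≡⟨ ⟦p⟧ ⟩
      ⟦ 0 ⟧                        ∎
      where open ≡-Reasoning

    *-distribˡ-+′ : ∀ x y z → x * (y + z) ≡ x * y + x * z
    *-distribˡ-+′ = onto (λ x y z → x * (y + z) ≡ x * y + x * z) λ a b c → begin
      ⟦ a ⟧ * (⟦ b ⟧ + ⟦ c ⟧)          ≡⟨ cong (⟦ a ⟧ *_) (⟦+⟧ b c) ⟩
      ⟦ a ⟧ * ⟦ b ℕ.+ c ⟧              ≡⟨ ⟦*⟧ a (b ℕ.+ c) ⟩
      ⟦ a ℕ.* (b ℕ.+ c) ⟧              ≡⟨ cong ⟦_⟧ (ℕ.*-distribˡ-+ a b c) ⟩
      ⟦ a ℕ.* b ℕ.+ a ℕ.* c ⟧          ≡⟨ ⟦+⟧ (a ℕ.* b) (a ℕ.* c) ⟨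
      ⟦ a ℕ.* b ⟧ + ⟦ a ℕ.* c ⟧        ≡⟨ cong₂ _+_ (⟦*⟧ a b) (⟦*⟧ a c) ⟨
      ⟦ a ⟧ * ⟦ b ⟧ + ⟦ a ⟧ * ⟦ c ⟧    ∎
      where open ≡-Reasoning

    *-distribʳ-+′ : ∀ x y z → (y + z) * x ≡ y * x + z * x
    *-distribʳ-+′ x y z = trans (*-comm′ (y + z) x)
      (trans (*-distribˡ-+′ x y z) (cong₂ _+_ (*-comm′ x y) (*-comm′ x z)))

  isCommutativeRing : IsCommutativeRing _≡_ _+_ _*_ -_ ⟦ 0 ⟧ ⟦ 1 ⟧
  isCommutativeRing = record
    { isRing = record
      { +-isAbelianGroup = record
        { isGroup = record
          { isMonoid = record
            { isSemigroup = record
              { isMagma = record { isEquivalence = isEquivalence ; ∙-cong = cong₂ _+_ }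
              ; assoc = +-assoc′ }
            ; identity = +-identityˡ′ , λ x → trans (+-comm′ x _) (+-identityˡ′ x) }
          ; inverse = (λ x → trans (+-comm′ _ x) (+-inverseʳ′ x)) , +-inverseʳ′
          ; ⁻¹-cong = cong (-_) }
        ; comm = +-comm′ }
      ; *-cong = cong₂ _*_
      ; *-assoc = *-assoc′
      ; *-identity = *-identityˡ′ , λ x → trans (*-comm′ x _) (*-identityˡ′ x)
      ; distrib = *-distribˡ-+′ , *-distribʳ-+′ }
    ; *-comm = *-comm′ }

  commutativeRing : CommutativeRing 0ℓ 0ℓ
  commutativeRing = record { isCommutativeRing = isCommutativeRing }

  open CommutativeRing commutativeRing public
    using (*-assoc; *-comm; *-identityˡ; zeroʳ; +-comm; +-assoc; +-identityˡ)
  open RingProperties (CommutativeRing.ring commutativeRing) public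
    using (-1*x≈-x; -‿distribˡ-*; -‿involutive; -‿injective; +-inverseʳ-unique; +-cancelˡ; ⁻¹-anti-homo‿-; -0#≈0#; x∙y⁻¹≈ε⇒x≈y; xyx⁻¹≈y; //-rightDividesˡ)

  private
    module Solver = SemiringSolver (CommutativeRing.commutativeSemiring commutativeRing)
    open Solver using (solve; _:=_; _:+_; _:*_)

  ⟦2⟧*x : ∀ x → ⟦ 2 ⟧ * x ≡ x + x
  ⟦2⟧*x x = begin
    ⟦ 2 ⟧ * x              ≡⟨ cong (_* x) (sym (⟦+⟧ 1 1)) ⟩
    (⟦ 1 ⟧ + ⟦ 1 ⟧) * x    ≡⟨ CommutativeRing.distribʳ commutativeRing x _ _ ⟩
    ⟦ 1 ⟧ * x + ⟦ 1 ⟧ * x  ≡⟨ cong₂ _+_ (*-identityˡ x) (*-identityˡ x) ⟩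
    x + x                  ∎
    where open ≡-Reasoning

  a+[b-a] : ∀ a b → a + (b - a) ≡ b
  a+[b-a] a b = trans (+-comm a _) (//-rightDividesˡ a b)

  -[a-b] : ∀ a b → - (a - b) ≡ b - a
  -[a-b] = ⁻¹-anti-homo‿-

  -‿nonzero : ∀ {x} → x ≢ ⟦ 0 ⟧ → - x ≢ ⟦ 0 ⟧
  -‿nonzero x≢0 -x≡0 = x≢0 (-‿injective (trans -x≡0 (sym -0#≈0#)))

  square*square : ∀ y z → (y * y) * (z * z) ≡ (y * z) * (y * z)
  square*square = solve 2 (λ y z → (y :* y) :* (z :* z) := (y :* z) :* (y :* z)) refl

  square? : ∀ x → Dec (∃ λ y → y * y ≡ x)
  square? x = Fin.any? λ y → y * y Fin.≟ x

  QR-neg : QR (- ⟦ 1 ⟧) → ∀ {x} → QR x → QR (- x)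
  QR-neg (_ , i , i²≡-1) {x} (x≢0 , y , y²≡x) = -‿nonzero x≢0 , i * y , (begin
    (i * y) * (i * y)  ≡⟨ sym (square*square i y) ⟩
    (i * i) * (y * y)  ≡⟨ cong₂ _*_ i²≡-1 y²≡x ⟩
    - ⟦ 1 ⟧ * x        ≡⟨ -1*x≈-x x ⟩
    - x                ∎)
    where open ≡-Reasoning

  QNR-neg : QR (- ⟦ 1 ⟧) → ∀ {x} → QNR x → QNR (- x)
  QNR-neg r {x} (x≢0 , ¬sq) = -‿nonzero x≢0 , λ sq →
    ¬sq (subst (λ z → ∃ λ y → y * y ≡ z) (-‿involutive x)
      (proj₂ (QR-neg r (-‿nonzero x≢0 , sq))))

  module Field (p-prime : Prime p) where

    inverse : ∀ {x} → x ≢ ⟦ 0 ⟧ → ∃ λ y → y * x ≡ ⟦ 1 ⟧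
    inverse {x} x≢0 = helper (coprime-Bézout (prime⇒coprime p-prime {{nz}} (Fin.toℕ<n x)))
      where
      open ≡-Reasoning
      nz : NonZero (toℕ x)
      nz = ℕ.≢-nonZero λ eq → x≢0 (trans (sym (⟦toℕ⟧ x)) (cong ⟦_⟧ eq))

      ⟦kp⟧ : ∀ k → ⟦ k ℕ.* p ⟧ ≡ ⟦ 0 ⟧
      ⟦kp⟧ k = trans (sym (⟦*⟧ k p)) (trans (cong (⟦ k ⟧ *_) ⟦p⟧) (zeroʳ ⟦ k ⟧))

      ⟦k⟧x : ∀ k → ⟦ k ⟧ * x ≡ ⟦ k ℕ.* toℕ x ⟧
      ⟦k⟧x k = trans (cong (⟦ k ⟧ *_) (sym (⟦toℕ⟧ x))) (⟦*⟧ k (toℕ x))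

      helper : Bézout.Identity 1 p (toℕ x) → ∃ λ y → y * x ≡ ⟦ 1 ⟧
      helper (Bézout.+- k l eq) = - ⟦ l ⟧ , (begin
        - ⟦ l ⟧ * x    ≡⟨ sym (-‿distribˡ-* ⟦ l ⟧ x) ⟩
        - (⟦ l ⟧ * x)  ≡⟨ cong (-_) (+-inverseʳ-unique ⟦ 1 ⟧ (⟦ l ⟧ * x) 1+lx≡0) ⟩
        - (- ⟦ 1 ⟧)    ≡⟨ -‿involutive ⟦ 1 ⟧ ⟩
        ⟦ 1 ⟧          ∎)
        where
        1+lx≡0 : ⟦ 1 ⟧ + ⟦ l ⟧ * x ≡ ⟦ 0 ⟧
        1+lx≡0 = begin
          ⟦ 1 ⟧ + ⟦ l ⟧ * x          ≡⟨ cong (⟦ 1 ⟧ +_) (⟦k⟧x l) ⟩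
          ⟦ 1 ⟧ + ⟦ l ℕ.* toℕ x ⟧    ≡⟨ ⟦+⟧ 1 (l ℕ.* toℕ x) ⟩
          ⟦ 1 ℕ.+ l ℕ.* toℕ x ⟧      ≡⟨ cong ⟦_⟧ eq ⟩
          ⟦ k ℕ.* p ⟧                ≡⟨ ⟦kp⟧ k ⟩
          ⟦ 0 ⟧                      ∎
      helper (Bézout.-+ k l eq) = ⟦ l ⟧ , (begin
        ⟦ l ⟧ * x                ≡⟨ ⟦k⟧x l ⟩
        ⟦ l ℕ.* toℕ x ⟧          ≡⟨ cong ⟦_⟧ (sym eq) ⟩
        ⟦ 1 ℕ.+ k ℕ.* p ⟧        ≡⟨ sym (⟦+⟧ 1 (k ℕ.* p)) ⟩
        ⟦ 1 ⟧ + ⟦ k ℕ.* p ⟧      ≡⟨ cong (⟦ 1 ⟧ +_) (⟦kp⟧ k) ⟩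
        ⟦ 1 ⟧ + ⟦ 0 ⟧            ≡⟨ trans (+-comm ⟦ 1 ⟧ ⟦ 0 ⟧) (+-identityˡ ⟦ 1 ⟧) ⟩
        ⟦ 1 ⟧                    ∎)

    *-cancelˡ : ∀ {c} → c ≢ ⟦ 0 ⟧ → ∀ {x y} → c * x ≡ c * y → x ≡ y
    *-cancelˡ {c} c≢0 {x} {y} cx≡cy with d , dc≡1 ← inverse c≢0 =
      trans (sym (undo x)) (trans (cong (d *_) cx≡cy) (undo y))
      where
      undo : ∀ z → d * (c * z) ≡ z
      undo z = trans (sym (*-assoc d c z)) (trans (cong (_* z) dc≡1) (*-identityˡ z))

    *-nonzero : ∀ {x y} → x ≢ ⟦ 0 ⟧ → y ≢ ⟦ 0 ⟧ → x * y ≢ ⟦ 0 ⟧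
    *-nonzero {x} x≢0 y≢0 xy≡0 = y≢0 (*-cancelˡ x≢0 (trans xy≡0 (sym (zeroʳ x))))

    square-cancelˡ : ∀ {c} → c ≢ ⟦ 0 ⟧ → ∀ {x y} → y * y ≡ (c * c) * x → ∃ λ z → z * z ≡ x
    square-cancelˡ {c} c≢0 {x} {y} eq with d , dc≡1 ← inverse c≢0 = d * y , (begin
      (d * y) * (d * y)        ≡⟨ sym (square*square d y) ⟩
      (d * d) * (y * y)        ≡⟨ cong ((d * d) *_) eq ⟩
      (d * d) * ((c * c) * x)  ≡⟨ sym (*-assoc _ _ x) ⟩
      (d * d) * (c * c) * x    ≡⟨ cong (_* x) (square*square d c) ⟩
      (d * c) * (d * c) * x    ≡⟨ cong (λ t → t * t * x) dc≡1 ⟩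
      ⟦ 1 ⟧ * ⟦ 1 ⟧ * x        ≡⟨ trans (*-assoc _ _ x) (trans (*-identityˡ _) (*-identityˡ x)) ⟩
      x                        ∎)
      where open ≡-Reasoning

    -- The product of two non-residues is a residue: otherwise the squares, their
    -- a-multiples and their b-multiples would be disjoint sets of ⌊p/2⌋ elements.
    QNR*QNR : 3 ℕ.< p → ∀ {a b} → QNR a → QNR b → QR (a * b)
    QNR*QNR 3<p {a} {b} (a≢0 , ¬sq-a) (b≢0 , ¬sq-b) with square? (a * b)
    ... | yes sq  = *-nonzero a≢0 b≢0 , sq
    ... | no ¬sq-ab = ⊥-elim (no-collision (Fin.pigeonhole p<3h f))
      where
      open ≡-Reasoning
      h : ℕ
      h = ℕ.⌊ p /2⌋

      2h≤p : h ℕ.+ h ℕ.≤ p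
      2h≤p = subst (h ℕ.+ h ℕ.≤_) (ℕ.⌊n/2⌋+⌈n/2⌉≡n p) (ℕ.+-monoʳ-≤ h (ℕ.⌊n/2⌋≤⌈n/2⌉ p))

      ⌈/2⌉≤ : ∀ n → ℕ.⌈ n /2⌉ ℕ.≤ suc ℕ.⌊ n /2⌋
      ⌈/2⌉≤ zero          = z≤n
      ⌈/2⌉≤ (suc zero)    = s≤s z≤n
      ⌈/2⌉≤ (suc (suc n)) = s≤s (⌈/2⌉≤ n)

      p<3h : p ℕ.< 3 ℕ.* h
      p<3h = subst (ℕ._< 3 ℕ.* h) (ℕ.⌊n/2⌋+⌈n/2⌉≡n p)
        (ℕ.+-monoʳ-< h (ℕ.≤-<-trans (⌈/2⌉≤ p)
          (ℕ.≤-trans (ℕ.+-monoˡ-≤ h (ℕ.⌊n/2⌋-mono 3<p))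
            (ℕ.≤-reflexive (cong (h ℕ.+_) (sym (ℕ.+-identityʳ h)))))))

      u : Fin h → 𝔽
      u i = ⟦ suc (toℕ i) ⟧

      u≢0 : ∀ i → u i ≢ ⟦ 0 ⟧
      u≢0 i = ⟦⟧≢0 (ℕ.≤-<-trans (Fin.toℕ<n i)
        (ℕ.<-≤-trans (ℕ.m<m+n h (ℕ.<-≤-trans (s≤s z≤n) (ℕ.⌊n/2⌋-mono 3<p))) 2h≤p))

      sum≢0 : ∀ i j → toℕ i ℕ.< toℕ j → u i + u j ≢ ⟦ 0 ⟧
      sum≢0 i j i<j eq = ⟦⟧≢0
        (ℕ.<-≤-trans (ℕ.+-mono-<-≤ (ℕ.≤-<-trans i<j (Fin.toℕ<n j)) (Fin.toℕ<n j)) 2h≤p)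
        (trans (sym (⟦+⟧ (suc (toℕ i)) (suc (toℕ j)))) eq)

      u-squares : ∀ i j → toℕ i ℕ.< toℕ j → u i * u i ≢ u j * u j
      u-squares i j i<j eq = ℕ.<-irrefl (ℕ.suc-injective (begin
        suc (toℕ i)      ≡⟨ sym (toℕ-u i) ⟩
        toℕ (u i)        ≡⟨ cong toℕ ui≡uj ⟩
        toℕ (u j)        ≡⟨ toℕ-u j ⟩
        suc (toℕ j)      ∎)) i<j
        where
        toℕ-u : ∀ i → toℕ (u i) ≡ suc (toℕ i)
        toℕ-u i = trans (toℕ-⟦⟧ _) (m<n⇒m%n≡m (ℕ.≤-<-trans (Fin.toℕ<n i)
          (ℕ.<-≤-trans (ℕ.m<m+n h (ℕ.<-≤-trans (s≤s z≤n) (ℕ.⌊n/2⌋-mono 3<p))) 2h≤p)))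

        expandˡ : ∀ x y → (x + y) * x ≡ x * x + x * y
        expandˡ = solve 2 (λ x y → (x :+ y) :* x := x :* x :+ x :* y) refl

        expandʳ : ∀ x y → (x + y) * y ≡ y * y + x * y
        expandʳ = solve 2 (λ x y → (x :+ y) :* y := y :* y :+ x :* y) refl

        ui≡uj : u i ≡ u j
        ui≡uj = *-cancelˡ (sum≢0 i j i<j) (trans (expandˡ (u i) (u j))
          (trans (cong (_+ u i * u j) eq) (sym (expandʳ (u i) (u j)))))

      u-injective : ∀ i j → u i * u i ≡ u j * u j → i ≡ j
      u-injective i j eq with ℕ.<-cmp (toℕ i) (toℕ j)
      ... | tri< i<j _ _ = ⊥-elim (u-squares i j i<j eq)
      ... | tri≈ _ i≡j _ = Fin.toℕ-injective i≡j
      ... | tri> _ _ j<i = ⊥-elim (u-squares j i j<i (sym eq))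

      c : Fin 3 → 𝔽
      c Fin.zero                     = ⟦ 1 ⟧
      c (Fin.suc Fin.zero)           = a
      c (Fin.suc (Fin.suc Fin.zero)) = b

      not-a : ∀ i j {d} → ¬ (∃ λ y → y * y ≡ d) → ⟦ 1 ⟧ * (u i * u i) ≢ d * (u j * u j)
      not-a i j {d} ¬sq eq = ¬sq (square-cancelˡ (u≢0 j)
        (trans (sym (*-identityˡ _)) (trans eq (*-comm d _))))

      not-ab : ∀ i j → a * (u i * u i) ≢ b * (u j * u j)
      not-ab i j eq = ¬sq-ab (square-cancelˡ (u≢0 i) (begin
        (b * u j) * (b * u j)    ≡⟨ rearrange₁ b (u j) ⟩
        b * (b * (u j * u j))    ≡⟨ cong (b *_) (sym eq) ⟩
        b * (a * (u i * u i))    ≡⟨ rearrange₂ a b (u i) ⟩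
        (u i * u i) * (a * b)    ∎))
        where
        rearrange₁ : ∀ b v → (b * v) * (b * v) ≡ b * (b * (v * v))
        rearrange₁ = solve 2 (λ b v → (b :* v) :* (b :* v) := b :* (b :* (v :* v))) refl
        rearrange₂ : ∀ a b v → b * (a * (v * v)) ≡ (v * v) * (a * b)
        rearrange₂ = solve 3 (λ a b v → b :* (a :* (v :* v)) := (v :* v) :* (a :* b)) refl

      separate : ∀ k l i j → c k * (u i * u i) ≡ c l * (u j * u j) → (k , i) ≡ (l , j)
      separate Fin.zero Fin.zero i j eq =
        cong (_ ,_) (u-injective i j (trans (sym (*-identityˡ _)) (trans eq (*-identityˡ _))))
      separate Fin.zero (Fin.suc Fin.zero) i j eq = ⊥-elim (not-a i j ¬sq-a eq)
      separate Fin.zero (Fin.suc (Fin.suc Fin.zero)) i j eq = ⊥-elim (not-a i j ¬sq-b eq)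
      separate (Fin.suc Fin.zero) Fin.zero i j eq = ⊥-elim (not-a j i ¬sq-a (sym eq))
      separate (Fin.suc Fin.zero) (Fin.suc Fin.zero) i j eq =
        cong (_ ,_) (u-injective i j (*-cancelˡ a≢0 eq))
      separate (Fin.suc Fin.zero) (Fin.suc (Fin.suc Fin.zero)) i j eq = ⊥-elim (not-ab i j eq)
      separate (Fin.suc (Fin.suc Fin.zero)) Fin.zero i j eq = ⊥-elim (not-a j i ¬sq-b (sym eq))
      separate (Fin.suc (Fin.suc Fin.zero)) (Fin.suc Fin.zero) i j eq = ⊥-elim (not-ab j i (sym eq))
      separate (Fin.suc (Fin.suc Fin.zero)) (Fin.suc (Fin.suc Fin.zero)) i j eq =
        cong (_ ,_) (u-injective i j (*-cancelˡ b≢0 eq))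

      g : Fin 3 × Fin h → 𝔽
      g (k , i) = c k * (u i * u i)

      f : Fin (3 ℕ.* h) → 𝔽
      f x = g (remQuot {3} h x)

      no-collision : ¬ (Σ (Fin (3 ℕ.* h)) λ x → ∃ λ y → x Fin.< y × f x ≡ f y)
      no-collision (x , y , x<y , fx≡fy) = Fin.<-irrefl x≡y x<y
        where
        x≡y : x ≡ y
        x≡y = begin
          x                                                              ≡⟨ sym (Fin.combine-remQuot {3} h x) ⟩
          combine (proj₁ (remQuot {3} h x)) (proj₂ (remQuot {3} h x))    ≡⟨ cong (λ t → combine (proj₁ t) (proj₂ t)) (separate (proj₁ (remQuot {3} h x)) (proj₁ (remQuot {3} h y)) (proj₂ (remQuot {3} h x)) (proj₂ (remQuot {3} h y)) fx≡fy) ⟩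
          combine (proj₁ (remQuot {3} h y)) (proj₂ (remQuot {3} h y))    ≡⟨ Fin.combine-remQuot {3} h y ⟩
          y                                                              ∎

module Paley (p : ℕ) .{{_ : NonZero p}} where
  open Residues p

  paleyGraph : QR (- ⟦ 1 ⟧) → Graph
  paleyGraph -1∈R = record
    { V        = 𝔽
    ; _~_      = λ a b → QR (a - b)
    ; ~-sym    = λ {a} {b} → subst QR (-[a-b] a b) ∘ QR-neg -1∈R
    ; ~-irrefl = λ { {a} refl (a-a≢0 , _) → a-a≢0 (CommutativeRing.-‿inverseʳ commutativeRing a) }
    }

  -- PaleyPath u v xs: xs is the vertex sequence of P_{u,v}, read from u to v.
  -- In `midpoint`, m is (a + b) / 2.
  data PaleyPath : 𝔽 → 𝔽 → Pred (List 𝔽) 0ℓ where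
    edge     : ∀ {a b} → QR (b - a) →
               PaleyPath a b (a ∷ b ∷ [])
    three    : ∀ {a b} → b - a ≡ ⟦ 3 ⟧ →
               PaleyPath a b (a ∷ a + ⟦ 1 ⟧ ∷ a + ⟦ 2 ⟧ ∷ b ∷ [])
    three˘   : ∀ {a b} → b - a ≡ ⟦ 3 ⟧ →
               PaleyPath b a (b ∷ a + ⟦ 2 ⟧ ∷ a + ⟦ 1 ⟧ ∷ a ∷ [])
    midpoint : ∀ {a b m} → QNR (b - a) → b - a ≢ ⟦ 3 ⟧ → b - a ≢ - ⟦ 3 ⟧ →
               ⟦ 2 ⟧ * m ≡ a + b →
               PaleyPath a b (a ∷ m ∷ b ∷ [])

  module _ (p-prime : Prime p) (-1∈R : QR (- ⟦ 1 ⟧)) (2∈N : QNR ⟦ 2 ⟧) (3∈N : QNR ⟦ 3 ⟧) where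
    open Field p-prime
    private
      G : Graph
      G = paleyGraph -1∈R
    open Graph G using (_~_; ~-sym)
    open ≡-Reasoning

    3<p′ : ∀ n → n ≡ p → 3 ℕ.< n
    3<p′ 0 eq = ⊥-elim (ℕ.≢-nonZero⁻¹ p (sym eq))
    3<p′ 1 eq = ⊥-elim (¬prime[1] (subst Prime (sym eq) p-prime))
    3<p′ 2 eq = ⊥-elim (proj₁ 2∈N (trans (cong ⟦_⟧ eq) ⟦p⟧))
    3<p′ 3 eq = ⊥-elim (proj₁ 3∈N (trans (cong ⟦_⟧ eq) ⟦p⟧))
    3<p′ (suc (suc (suc (suc n)))) eq = s≤s (s≤s (s≤s (s≤s z≤n)))

    3<p : 3 ℕ.< p
    3<p = 3<p′ p refl

    1∈R : QR ⟦ 1 ⟧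
    1∈R = ⟦⟧≢0 (ℕ.<-trans (s≤s (s≤s z≤n)) 3<p) , ⟦ 1 ⟧ , *-identityˡ ⟦ 1 ⟧

    difference : ∀ {x y d} → x + d ≡ y → y - x ≡ d
    difference {x} {y} {d} eq = trans (cong (_- x) (sym eq)) (xyx⁻¹≈y x d)

    shift : ∀ {x y d} → y - x ≡ d → x + d ≡ y
    shift {x} {y} eq = trans (cong (x +_) (sym eq)) (a+[b-a] x y)

    step : ∀ {x y d} → x + d ≡ y → QR d → x ~ y
    step {x} {y} eq d∈R = ~-sym (subst QR (sym (difference eq)) d∈R)

    apart : ∀ {x y d} → x + d ≡ y → d ≢ ⟦ 0 ⟧ → x ≢ y
    apart {x} eq d≢0 x≡y = d≢0 (+-cancelˡ x _ _
      (trans eq (trans (sym x≡y) (sym (trans (+-comm x _) (+-identityˡ x))))))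

    plus : ∀ x m n → (x + ⟦ m ⟧) + ⟦ n ⟧ ≡ x + ⟦ m ℕ.+ n ⟧
    plus x m n = trans (+-assoc x _ _) (cong (x +_) (⟦+⟧ m n))

    1≢0 : ⟦ 1 ⟧ ≢ ⟦ 0 ⟧
    1≢0 = proj₁ 1∈R

    2≢0 : ⟦ 2 ⟧ ≢ ⟦ 0 ⟧
    2≢0 = proj₁ 2∈N

    3≢0 : ⟦ 3 ⟧ ≢ ⟦ 0 ⟧
    3≢0 = proj₁ 3∈N

    three-path : ∀ {a b} → b - a ≡ ⟦ 3 ⟧ →
                 IsPath G a b (a ∷ a + ⟦ 1 ⟧ ∷ a + ⟦ 2 ⟧ ∷ b ∷ [])
    three-path {a} {b} eq =
      (step refl 1∈R ∷ step (plus a 1 1) 1∈R ∷ step 2→3 1∈R ∷ [-]) ,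
      (apart refl 1≢0 ∷ apart refl 2≢0 ∷ apart a+3≡b 3≢0 ∷ []) ∷
      (apart (plus a 1 1) 1≢0 ∷ apart (trans (plus a 1 2) a+3≡b) 2≢0 ∷ []) ∷
      (apart 2→3 1≢0 ∷ []) ∷ [] ∷ []
      where
      a+3≡b : a + ⟦ 3 ⟧ ≡ b
      a+3≡b = shift eq
      2→3 : (a + ⟦ 2 ⟧) + ⟦ 1 ⟧ ≡ b
      2→3 = trans (plus a 2 1) a+3≡b

    reverse-path : ∀ {a b c d} → IsPath G a d (a ∷ b ∷ c ∷ d ∷ []) → IsPath G d a (d ∷ c ∷ b ∷ a ∷ [])
    reverse-path ((e₁ ∷ e₂ ∷ e₃ ∷ [-]) , ((n₁ ∷ n₂ ∷ n₃ ∷ []) ∷ (n₄ ∷ n₅ ∷ []) ∷ (n₆ ∷ []) ∷ _)) =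
      (~-sym e₃ ∷ ~-sym e₂ ∷ ~-sym e₁ ∷ [-]) ,
      (≢-sym n₆ ∷ ≢-sym n₅ ∷ ≢-sym n₃ ∷ []) ∷ (≢-sym n₄ ∷ ≢-sym n₂ ∷ []) ∷ (≢-sym n₁ ∷ []) ∷ [] ∷ []

    half-residue : ∀ {d} → QNR (⟦ 2 ⟧ * d) → QR d
    half-residue {d} 2d∈N@(2d≢0 , _) with QNR*QNR 3<p 2∈N 2d∈N
    ... | _ , y , y²≡ =
      (λ { refl → 2d≢0 (zeroʳ ⟦ 2 ⟧) }) ,
      square-cancelˡ 2≢0 (trans y²≡ (sym (*-assoc ⟦ 2 ⟧ ⟦ 2 ⟧ d)))

    -- That is, m - a = b - m = (b - a) / 2.
    halves : ∀ {a b m} → ⟦ 2 ⟧ * m ≡ a + b →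
             ⟦ 2 ⟧ * (m - a) ≡ b - a × m + (m - a) ≡ b
    halves {a} {b} {m} eq = 2[m-a]≡b-a , m+[m-a]≡b
      where
      m+[m-a]≡b : m + (m - a) ≡ b
      m+[m-a]≡b = begin
        m + (m - a)        ≡⟨ sym (+-assoc m m (- a)) ⟩
        (m + m) - a        ≡⟨ cong (_- a) (trans (sym (⟦2⟧*x m)) eq) ⟩
        (a + b) - a        ≡⟨ xyx⁻¹≈y a b ⟩
        b                  ∎
      2[m-a]≡b-a : ⟦ 2 ⟧ * (m - a) ≡ b - a
      2[m-a]≡b-a = begin
        ⟦ 2 ⟧ * (m - a)          ≡⟨ ⟦2⟧*x (m - a) ⟩
        (m - a) + (m - a)        ≡⟨ cong (_+ (m - a)) (+-comm m (- a)) ⟩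
        (- a + m) + (m - a)      ≡⟨ +-assoc (- a) m (m - a) ⟩
        - a + (m + (m - a))      ≡⟨ cong (- a +_) m+[m-a]≡b ⟩
        - a + b                  ≡⟨ +-comm (- a) b ⟩
        b - a                    ∎

    midpoint-path : ∀ {a b m} → QNR (b - a) → ⟦ 2 ⟧ * m ≡ a + b → IsPath G a b (a ∷ m ∷ b ∷ [])
    midpoint-path {a} {b} {m} b-a∈N eq with 2d≡ , m→b ← halves eq =
      (step a→m d∈R ∷ step m→b d∈R ∷ [-]) ,
      (apart a→m (proj₁ d∈R) ∷ apart (a+[b-a] a b) (proj₁ b-a∈N) ∷ []) ∷
      (apart m→b (proj₁ d∈R) ∷ []) ∷ [] ∷ []
      where
      a→m : a + (m - a) ≡ m
      a→m = a+[b-a] a m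
      d∈R : QR (m - a)
      d∈R = half-residue (subst QNR (sym 2d≡) b-a∈N)

    isPath : ∀ {u v xs} → PaleyPath u v xs → IsPath G u v xs
    isPath (edge {a} {b} r) =
      (~-sym r ∷ [-]) , (apart (a+[b-a] a b) (proj₁ r) ∷ []) ∷ [] ∷ []
    isPath (three eq)               = three-path eq
    isPath (three˘ eq)              = reverse-path (three-path eq)
    isPath (midpoint n _ _ eq)      = midpoint-path n eq

    flip≢ : ∀ {a b c} → b - a ≢ - c → a - b ≢ c
    flip≢ {a} {b} ≢-c eq = ≢-c (trans (sym (-[a-b] a b)) (cong (-_) eq))

    flip≢′ : ∀ {a b c} → b - a ≢ c → a - b ≢ - c
    flip≢′ {a} {b} {c} ≢c eq =
      ≢c (trans (sym (-[a-b] a b)) (trans (cong (-_) eq) (-‿involutive c)))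

    isReversed : ∀ {u v xs} → PaleyPath u v xs → PaleyPath v u (reverse xs)
    isReversed (edge {a} {b} r)   = edge (subst QR (-[a-b] b a) (QR-neg -1∈R r))
    isReversed (three eq)         = three˘ eq
    isReversed (three˘ eq)        = three eq
    isReversed (midpoint {a} {b} n ≢3 ≢-3 eq) =
      midpoint (subst QNR (-[a-b] b a) (QNR-neg -1∈R n)) (flip≢ ≢-3) (flip≢′ ≢3)
        (trans eq (+-comm a b))

    ¬QR&3 : ∀ {d} → QR d → d ≢ ⟦ 3 ⟧
    ¬QR&3 (_ , sq) refl = proj₂ 3∈N sq

    ¬QR&-3 : ∀ {a b} → QR (b - a) → a - b ≢ ⟦ 3 ⟧
    ¬QR&-3 {a} {b} r = ¬QR&3 (subst QR (-[a-b] b a) (QR-neg -1∈R r))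

    ¬±3 : ∀ {a b} → b - a ≡ ⟦ 3 ⟧ → a - b ≢ ⟦ 3 ⟧
    ¬±3 {a} {b} eq eq′ = *-nonzero 2≢0 3≢0 (begin
      ⟦ 2 ⟧ * ⟦ 3 ⟧        ≡⟨ ⟦2⟧*x ⟦ 3 ⟧ ⟩
      ⟦ 3 ⟧ + ⟦ 3 ⟧        ≡⟨ cong₂ _+_ (sym eq) (sym eq′) ⟩
      (b - a) + (a - b)    ≡⟨ cong ((b - a) +_) (sym (-[a-b] b a)) ⟩
      (b - a) - (b - a)    ≡⟨ CommutativeRing.-‿inverseʳ commutativeRing (b - a) ⟩
      ⟦ 0 ⟧                ∎)

    isUnique : ∀ {u v xs ys} → PaleyPath u v xs → PaleyPath u v ys → xs ≡ ys
    isUnique (edge _)              (edge _)               = refl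
    isUnique (edge r)              (three eq)             = ⊥-elim (¬QR&3 r eq)
    isUnique (edge r)              (three˘ eq)            = ⊥-elim (¬QR&-3 r eq)
    isUnique (edge r)              (midpoint n _ _ _)     = ⊥-elim (proj₂ n (proj₂ r))
    isUnique (three eq)            (edge r)               = ⊥-elim (¬QR&3 r eq)
    isUnique (three _)             (three _)              = refl
    isUnique (three eq)            (three˘ eq′)           = ⊥-elim (¬±3 eq eq′)
    isUnique (three eq)            (midpoint _ ≢3 _ _)    = ⊥-elim (≢3 eq)
    isUnique (three˘ eq)           (edge r)               = ⊥-elim (¬QR&-3 r eq)
    isUnique (three˘ eq)           (three eq′)            = ⊥-elim (¬±3 eq eq′)
    isUnique (three˘ _)            (three˘ _)             = refl
    isUnique (three˘ eq)           (midpoint _ _ ≢-3 _)   = ⊥-elim (flip≢ ≢-3 eq)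
    isUnique (midpoint n _ _ _)    (edge r)               = ⊥-elim (proj₂ n (proj₂ r))
    isUnique (midpoint _ ≢3 _ _)   (three eq)             = ⊥-elim (≢3 eq)
    isUnique (midpoint _ _ ≢-3 _)  (three˘ eq)            = ⊥-elim (flip≢ ≢-3 eq)
    isUnique (midpoint _ _ _ eq)   (midpoint _ _ _ eq′)   =
      cong (λ m → _ ∷ m ∷ _ ∷ []) (*-cancelˡ 2≢0 (trans eq (sym eq′)))

    exists : ∀ {u v} → u ≢ v → ∃ (PaleyPath u v)
    exists {u} {v} u≢v with square? (v - u) | v - u Fin.≟ ⟦ 3 ⟧ | v - u Fin.≟ - ⟦ 3 ⟧
    ... | yes sq | _      | _       = _ , edge ((λ eq → u≢v (sym (x∙y⁻¹≈ε⇒x≈y v u eq))) , sq)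
    ... | no _   | yes eq | _       = _ , three eq
    ... | no _   | no _   | yes eq  =
      _ , three˘ (trans (sym (-[a-b] v u)) (trans (cong (-_) eq) (-‿involutive ⟦ 3 ⟧)))
    ... | no ¬sq | no ≢3  | no ≢-3 with y , y2≡1 ← inverse 2≢0 =
      _ , midpoint ((λ eq → u≢v (sym (x∙y⁻¹≈ε⇒x≈y v u eq))) , ¬sq) ≢3 ≢-3 (begin
        ⟦ 2 ⟧ * (y * (u + v))  ≡⟨ sym (*-assoc ⟦ 2 ⟧ y (u + v)) ⟩
        ⟦ 2 ⟧ * y * (u + v)    ≡⟨ cong (_* (u + v)) (trans (*-comm ⟦ 2 ⟧ y) y2≡1) ⟩
        ⟦ 1 ⟧ * (u + v)        ≡⟨ *-identityˡ (u + v) ⟩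
        u + v                  ∎)

    paleySystem : PathSystem (paleyGraph -1∈R)
    paleySystem = record
      { 𝒫           = PaleyPath
      ; paths       = isPath
      ; reversed    = isReversed
      ; exactly-one = λ u≢v → let xs , P = exists u≢v in xs , P , isUnique P
      }

{-# OPTIONS --safe #-}

-- Irreducibility. Colour ℕ by the side of the reduction on which n mod p lies.
-- If all monochromatic runs have length at least K but some run has length
-- exactly K, then three consecutive blocks of length K alternate in colour. For
-- a residue d with 2d ≠ ±3 and K < 2d < 3K some x, x + d, x + 2d lie in the
-- three blocks, one in each, although x + d lies on the path from x to x + 2d.
-- Such a d exists among the numbers 2^i 3^j with i + j even, except for K = 2,
-- where the path from x to x + 3 is used instead. So runs are arbitrarily long
-- and the colouring is constant.
--
-- Non-metrizability. Averaging a weight over translations gives an even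
-- function g on residues with 2 g(u) ≤ g(x) + g(y) whenever x + y = 2u ≠ ±3, and
-- 3 g(1) ≤ g(4) + g(-1), that is 2 g(1) ≤ g(4). Maximise g over the group
-- generated by 4 and 6, without the u such that 2u = ±3. By 2u = 6u - 4u (and
-- 2u = 8u/3 - 2u/3 when 4u or 6u is one of the excluded elements) the set of
-- maximisers is closed under multiplication by 4 and by 6, hence contains 1,
-- contradicting 2 g(1) ≤ g(4).
module Submission where

open import Defs
open import Algebra.Bundles using (CommutativeMonoid; CommutativeRing)
import Algebra.Properties.CommutativeMonoid.Sum as Sum
import Algebra.Solver.Ring.NaturalCoefficients.Default as SemiringSolver
open import Data.Bool.Base using (Bool; true; false; T)
import Data.Bool.Properties as Bool
open import Data.Empty using (⊥; ⊥-elim)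
open import Data.Fin.Base using (Fin; zero; suc; toℕ)
import Data.Fin.Properties as Fin
open import Data.Fin.Permutation using (Permutation′; permutation)
open import Data.List.Base using (List; []; _∷_)
open import Data.List.Relation.Unary.All using (All; []; _∷_)
import Data.List.Relation.Unary.All as All
open import Data.List.Relation.Unary.AllPairs using ([]; _∷_)
open import Data.Nat.Base using (ℕ; zero; suc; _>_; NonZero; z≤n; s≤s)
import Data.Nat.Base as ℕ
open import Data.Nat.GeneralisedArithmetic using (iterate)
open import Data.Nat.Primality using (Prime)
import Data.Nat.Properties as ℕ
open import Data.Nat.Tactic.RingSolver using (solve-∀)
open import Data.Product.Base using (∃; _×_; _,_; proj₁; proj₂)
open import Data.Rational.Base using (ℚ; 0ℚ; ½)
import Data.Rational.Base as ℚ
import Data.Rational.Properties as ℚ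
import Data.Rational.Solver as ℚ
open import Data.Sum.Base using (_⊎_; inj₁; inj₂; [_,_])
open import Function.Base using (_∘_)
open import Function.Definitions using (Injective)
open import Level using (0ℓ)
open import Relation.Binary.Bundles using (Preorder)
open import Relation.Binary.PropositionalEquality hiding ([_])
import Relation.Binary.Reasoning.Preorder as PreorderReasoning
import Relation.Binary.Reasoning.Setoid as SetoidReasoning
open import Relation.Binary.Structures using (IsEquivalence)
open import Relation.Nullary using (¬_; Dec; yes; no)
open import Relation.Nullary.Decidable using (_⊎-dec_)
open import Relation.Nullary.Decidable.Core using (¬¬-excluded-middle)
open import Relation.Unary using (Pred)

-- Run lengths in periodic two-colourings of ℕ.

≢-agree : ∀ {a b c : Bool} → a ≢ b → c ≢ b → c ≡ a
≢-agree {a} {b} {c} a≢b c≢b = trans (Bool.¬-not c≢b) (sym (Bool.¬-not a≢b))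

module Runs where
  open import Data.Nat.Base
  open import Data.Nat.Properties

  -- `i`, `j`, `l` are positions inside three consecutive blocks of length `K`. If `d` is `K - e`,
  -- they are `2e`, `e`, `0`; if `d` is `K + e`, they are `0`, `e`, `2e`. The lower bound on `2d` in
  -- the first case and the upper bound in the second amount to `2e < K`.
  offsets : ∀ {K d} → K < d + d → d + d < K + K + K →
            ∃ λ i → ∃ λ j → ∃ λ l → (i < K × j < K × l < K) × i + d ≡ K + j × j + d ≡ K + l
  offsets {K} {d} K<2d 2d<3K with ≤-total d K
  ... | inj₁ d≤K with e , refl ← m≤n⇒∃[o]m+o≡n d≤K =
    e + e , e , 0 , (+-monoˡ-< e e<d , m<n+m e 0<d , <-≤-trans 0<d (m≤m+n d e)) ,
    lemma₁ d e , lemma₂ d e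
    where
    e<d : e < d
    e<d = +-cancelˡ-< d e d K<2d
    0<d : 0 < d
    0<d = ≤-<-trans z≤n e<d
    lemma₁ : ∀ d e → e + e + d ≡ d + e + e
    lemma₁ = solve-∀
    lemma₂ : ∀ d e → e + d ≡ d + e + 0
    lemma₂ = solve-∀
  ... | inj₂ K≤d with e , refl ← m≤n⇒∃[o]m+o≡n K≤d =
    0 , e , e + e , (≤-<-trans z≤n 2e<K , ≤-<-trans (m≤m+n e e) 2e<K , 2e<K) , refl , lemma₁ K e
    where
    lemma₁ : ∀ K e → e + (K + e) ≡ K + (e + e)
    lemma₁ = solve-∀
    lemma₂ : ∀ K e → K + e + (K + e) ≡ K + K + (e + e)
    lemma₂ = solve-∀
    2e<K : e + e < K
    2e<K = +-cancelˡ-< (K + K) (e + e) K (subst (_< K + K + K) (lemma₂ K e) 2d<3K)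

  module Colouring (f : ℕ → Bool) (p : ℕ) (0<p : 0 < p) (periodic : ∀ n → f (n + p) ≡ f n) where

    Midpoint : ℕ → Set
    Midpoint d = ∀ x → f x ≡ f (x + d + d) → f (x + d) ≡ f x

    Boundary : ℕ → Set
    Boundary x = f x ≢ f (suc x)

    -- Runs are measured forwards from a `Boundary`, so a constant colouring satisfies this for
    -- every `K`.
    RunsOf : ℕ → Set
    RunsOf K = ∀ x → Boundary x → ∀ i → i < K → f (suc x + i) ≡ f (suc x)

    periodic* : ∀ k n → f (n + k * p) ≡ f n
    periodic* zero    n = cong f (+-identityʳ n)
    periodic* (suc k) n = begin
      f (n + (p + k * p))  ≡⟨ cong f (lemma n p (k * p)) ⟩
      f (n + k * p + p)    ≡⟨ periodic _ ⟩
      f (n + k * p)        ≡⟨ periodic* k n ⟩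
      f n                  ∎
      where
      open ≡-Reasoning
      lemma : ∀ n p m → n + (p + m) ≡ n + m + p
      lemma = solve-∀

    -- Walk left from `x`. A colour change between `z` and `suc z` would start a run of at least `K`
    -- places, and that run would reach across the boundary to `suc x`.
    run-before : ∀ {K x} → RunsOf K → Boundary x → ∀ j z → j < K → j + z ≡ x → f z ≡ f x
    run-before runs bd zero    z j<K refl = refl
    run-before {K} {x} runs bd (suc j) z j<K eq with f z Bool.≟ f (suc z)
    ... | yes fz≡ = trans fz≡ (run-before runs bd j (suc z) (<-trans (n<1+n j) j<K) (trans (+-suc j z) eq))
    ... | no bd′ = ⊥-elim (bd (begin
      f x                ≡⟨ run-before runs bd j (suc z) (<-trans (n<1+n j) j<K) (trans (+-suc j z) eq) ⟨
      f (suc z)          ≡⟨ runs z bd′ (suc j) j<K ⟨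
      f (suc z + suc j)  ≡⟨ cong (λ n → f (suc n)) (trans (+-comm z (suc j)) eq) ⟩
      f (suc x)          ∎))
      where open ≡-Reasoning

    -- If the run stopped after `K` places, the points `y + i`, `y + i + d`, `y + i + d + d` from
    -- `offsets` would lie in three blocks of alternating colour, against `Midpoint d`. The
    -- hypothesis on `y` guarantees that a full block fits to the left of the boundary.
    run-exact : ∀ {K d} → RunsOf K → Midpoint d → K < d + d → d + d < K + K + K →
                ∀ y x → y + K ≡ suc x → Boundary x → f (suc x + K) ≡ f (suc x)
    run-exact {K} {d} runs mid K<2d 2d<3K y x y+K≡ bd
      with f (suc x + K) Bool.≟ f (suc x)
    ... | yes eq = eq
    ... | no short with i , j , l , (i<K , j<K , l<K) , i+d , j+d ← offsets {K} {d} K<2d 2d<3K =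
      ⊥-elim (bd (begin
        f x                ≡⟨ left ⟨
        f (y + i)          ≡⟨ mid (y + i) (trans left (sym right)) ⟨
        f (y + i + d)      ≡⟨ cong f centre ⟩
        f (suc x + j)      ≡⟨ runs x bd j j<K ⟩
        f (suc x)          ∎))
      where
      open ≡-Reasoning
      centre : y + i + d ≡ suc x + j
      centre = begin
        y + i + d    ≡⟨ +-assoc y i d ⟩
        y + (i + d)  ≡⟨ cong (y +_) i+d ⟩
        y + (K + j)  ≡⟨ +-assoc y K j ⟨
        y + K + j    ≡⟨ cong (_+ j) y+K≡ ⟩
        suc x + j    ∎
      left : f (y + i) ≡ f x
      left = run-before runs bd (K ∸ suc i) (y + i) (∸-monoʳ-< (s≤s z≤n) i<K) (suc-injective (begin
        suc (K ∸ suc i + (y + i))  ≡⟨ lemma (K ∸ suc i) y i ⟩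
        y + (K ∸ suc i + suc i)    ≡⟨ cong (y +_) (m∸n+n≡m i<K) ⟩
        y + K                      ≡⟨ y+K≡ ⟩
        suc x                      ∎))
        where
        lemma : ∀ a y i → suc (a + (y + i)) ≡ y + (a + suc i)
        lemma = solve-∀
      -- The middle block ends at `x + K`, so `short` makes a boundary there and the third block is
      -- again the start of a run.
      last : f (x + K) ≡ f (suc x)
      last = trans (cong f (begin
        x + K              ≡⟨ cong (x +_) (sym (m+[n∸m]≡n (≤-<-trans z≤n i<K))) ⟩
        x + suc (K ∸ 1)    ≡⟨ +-suc x (K ∸ 1) ⟩
        suc x + (K ∸ 1)    ∎)) (runs x bd (K ∸ 1) (∸-monoʳ-< (s≤s z≤n) (≤-<-trans z≤n i<K)))
      right : f (y + i + d + d) ≡ f x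
      right = begin
        f (y + i + d + d)    ≡⟨ cong f (begin
          y + i + d + d    ≡⟨ cong (_+ d) centre ⟩
          suc x + j + d    ≡⟨ +-assoc (suc x) j d ⟩
          suc x + (j + d)  ≡⟨ cong (suc x +_) j+d ⟩
          suc x + (K + l)  ≡⟨ +-assoc (suc x) K l ⟨
          suc x + K + l    ∎) ⟩
        f (suc x + K + l)    ≡⟨ runs (x + K) (λ eq → short (trans (sym eq) last)) l l<K ⟩
        f (suc x + K)        ≡⟨ ≢-agree bd short ⟩
        f x                  ∎

    -- Only the place at index `K` is new. Shifting by `K` periods makes room for a block on the
    -- left, as `run-exact` requires.
    lengthen : ∀ {K d} → RunsOf K → Midpoint d → K < d + d → d + d < K + K + K → RunsOf (suc K)
    lengthen {K} {d} runs mid K<2d 2d<3K x bd i (s≤s i≤K) with m≤n⇒m<n∨m≡n i≤K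
    ... | inj₁ i<K  = runs x bd i i<K
    ... | inj₂ refl = begin
      f (suc x + K)      ≡⟨ periodic* K (suc x + K) ⟨
      f (suc x + K + K * p)  ≡⟨ cong f (lemma (suc x) K (K * p)) ⟩
      f (suc x′ + K)     ≡⟨ run-exact runs mid K<2d 2d<3K (suc x′ ∸ K) x′
                              (m∸n+n≡m K≤x′) (λ eq → bd (trans (sym (periodic* K x)) (trans eq (periodic* K (suc x))))) ⟩
      f (suc x′)         ≡⟨ periodic* K (suc x) ⟩
      f (suc x)          ∎
      where
      open ≡-Reasoning
      x′ : ℕ
      x′ = x + K * p
      K≤x′ : K ≤ suc x′
      K≤x′ = ≤-trans (m≤m*n K p {{>-nonZero 0<p}}) (≤-trans (m≤n+m (K * p) x) (n≤1+n x′))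
      lemma : ∀ a b c → a + b + c ≡ a + c + b
      lemma = solve-∀

    -- A run of `p` places after a boundary at `n` ends at `n + p`, which has the colour of `n`.
    constant : RunsOf p → ∀ n → f n ≡ f 0
    constant runs zero    = refl
    constant runs (suc n) with f n Bool.≟ f (suc n)
    ... | yes eq = trans (sym eq) (constant runs n)
    ... | no bd  = ⊥-elim (bd (begin
      f n                  ≡⟨ periodic n ⟨
      f (n + p)            ≡⟨ cong f (trans (cong (n +_) (sym (m+[n∸m]≡n 0<p))) (+-suc n (p ∸ 1))) ⟩
      f (suc n + (p ∸ 1))  ≡⟨ runs n bd (p ∸ 1) (∸-monoʳ-< (s≤s z≤n) 0<p) ⟩
      f (suc n)            ∎))
      where open ≡-Reasoning

-- Order and finite sums of Cauchy reals.

module RealProperties where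
  open Real
  open ℚ.+-*-Solver using (solve; _:=_; _:+_; :-_; _:-_)

  private
    half : ℚ → ℚ
    half ε = ½ ℚ.* ε

    half>0 : ∀ {ε} → 0ℚ ℚ.< ε → 0ℚ ℚ.< half ε
    half>0 {ε} 0<ε = subst (ℚ._< half ε) (ℚ.*-zeroʳ ½) (ℚ.*-monoʳ-<-pos ½ 0<ε)

    half+half : ∀ ε → half ε ℚ.+ half ε ≡ ε
    half+half ε = trans (sym (ℚ.*-distribʳ-+ ε ½ ½)) (ℚ.*-identityˡ ε)

    +-cancelʳ-≤ : ∀ r {p q} → p ℚ.+ r ℚ.≤ q ℚ.+ r → p ℚ.≤ q
    +-cancelʳ-≤ r {p} {q} p+r≤q+r = subst₂ ℚ._≤_ (undo p r) (undo q r) (ℚ.+-monoˡ-≤ (ℚ.- r) p+r≤q+r)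
      where
      undo : ∀ p r → (p ℚ.+ r) ℚ.+ (ℚ.- r) ≡ p
      undo = solve 2 (λ p r → (p :+ r) :+ (:- r) := p) refl

    p≤p+ε : ∀ p {ε} → 0ℚ ℚ.< ε → p ℚ.≤ p ℚ.+ ε
    p≤p+ε p {ε} 0<ε = subst (ℚ._≤ p ℚ.+ ε) (ℚ.+-identityʳ p) (ℚ.+-monoʳ-≤ p (ℚ.<⇒≤ 0<ε))

    p≤∣p∣ : ∀ p → p ℚ.≤ ℚ.∣ p ∣
    p≤∣p∣ p with ℚ.≤-total 0ℚ p
    ... | inj₁ 0≤p = ℚ.≤-reflexive (sym (ℚ.0≤p⇒∣p∣≡p 0≤p))
    ... | inj₂ p≤0 = ℚ.≤-trans p≤0 (ℚ.0≤∣p∣ p)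

    close⇒≤ : ∀ {p q ε} → ℚ.∣ p ℚ.- q ∣ ℚ.< ε → p ℚ.≤ q ℚ.+ ε
    close⇒≤ {p} {q} {ε} close = begin
      p                ≡⟨ solve 2 (λ p q → p := q :+ (p :- q)) refl p q ⟩
      q ℚ.+ (p ℚ.- q)  ≤⟨ ℚ.+-monoʳ-≤ q (ℚ.≤-trans (p≤∣p∣ (p ℚ.- q)) (ℚ.<⇒≤ close)) ⟩
      q ℚ.+ ε          ∎
      where open ℚ.≤-Reasoning

  -- Records, so that the two reals can be inferred from the type.
  infix 4 _≼_ _≐_
  record _≼_ (x y : ℝ) : Set where
    constructor wrap
    field bound : x ≤ y

  record _≐_ (x y : ℝ) : Set where
    constructor wrap
    field at : ∀ n → seq x n ≡ seq y n

  open _≼_ public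
  open _≐_ public

  ≐⇒≼ : ∀ {x y} → x ≐ y → x ≼ y
  ≐⇒≼ {x} {y} eq .bound ε 0<ε = 0 , λ n _ →
    subst (ℚ._≤ seq y n ℚ.+ ε) (sym (eq .at n)) (p≤p+ε (seq y n) 0<ε)

  ≼-refl : ∀ {x} → x ≼ x
  ≼-refl = ≐⇒≼ (wrap λ _ → refl)

  ≼-trans : ∀ {x y z} → x ≼ y → y ≼ z → x ≼ z
  ≼-trans {x} {y} {z} x≼y y≼z .bound ε 0<ε
    with M , hx ← x≼y .bound (half ε) (half>0 0<ε) | N , hy ← y≼z .bound (half ε) (half>0 0<ε) =
    M ℕ.⊔ N , λ n ≤n → begin
      seq x n                            ≤⟨ hx n (ℕ.m⊔n≤o⇒m≤o M N ≤n) ⟩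
      seq y n ℚ.+ half ε                 ≤⟨ ℚ.+-monoˡ-≤ (half ε) (hy n (ℕ.m⊔n≤o⇒n≤o M N ≤n)) ⟩
      (seq z n ℚ.+ half ε) ℚ.+ half ε    ≡⟨ ℚ.+-assoc (seq z n) (half ε) (half ε) ⟩
      seq z n ℚ.+ (half ε ℚ.+ half ε)    ≡⟨ cong (seq z n ℚ.+_) (half+half ε) ⟩
      seq z n ℚ.+ ε                      ∎
    where open ℚ.≤-Reasoning

  -- Addition made opaque: otherwise unification η-expands sums of reals.
  infixl 6 _⊕_
  opaque
    _⊕_ : ℝ → ℝ → ℝ
    _⊕_ = _+_

    +≡⊕ : ∀ x y → x + y ≡ x ⊕ y
    +≡⊕ x y = refl

    ⊕-mono-≼ : ∀ {x y u v} → x ≼ y → u ≼ v → x ⊕ u ≼ y ⊕ v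
    ⊕-mono-≼ {x} {y} {u} {v} x≼y u≼v .bound ε 0<ε
      with M , hx ← x≼y .bound (half ε) (half>0 0<ε) | N , hu ← u≼v .bound (half ε) (half>0 0<ε) =
      M ℕ.⊔ N , λ n ≤n → begin
        seq x n ℚ.+ seq u n
          ≤⟨ ℚ.+-mono-≤ (hx n (ℕ.m⊔n≤o⇒m≤o M N ≤n)) (hu n (ℕ.m⊔n≤o⇒n≤o M N ≤n)) ⟩
        (seq y n ℚ.+ half ε) ℚ.+ (seq v n ℚ.+ half ε)
          ≡⟨ solve 3 (λ y v h → (y :+ h) :+ (v :+ h) := (y :+ v) :+ (h :+ h)) refl (seq y n) (seq v n) (half ε) ⟩
        (seq y n ℚ.+ seq v n) ℚ.+ (half ε ℚ.+ half ε)
          ≡⟨ cong ((seq y n ℚ.+ seq v n) ℚ.+_) (half+half ε) ⟩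
        (seq y n ℚ.+ seq v n) ℚ.+ ε
          ∎
      where open ℚ.≤-Reasoning

    ⊕-cancelʳ-≼ : ∀ z {x y} → x ⊕ z ≼ y ⊕ z → x ≼ y
    ⊕-cancelʳ-≼ z {x} {y} x⊕z≼y⊕z .bound ε 0<ε with N , h ← x⊕z≼y⊕z .bound ε 0<ε =
      N , λ n ≤n → +-cancelʳ-≤ (seq z n) (ℚ.≤-trans (h n ≤n) (ℚ.≤-reflexive
        (solve 3 (λ y z e → (y :+ z) :+ e := (y :+ e) :+ z) refl (seq y n) (seq z n) ε)))

    ⊕-cong : ∀ {x y u v} → x ≐ y → u ≐ v → x ⊕ u ≐ y ⊕ v
    ⊕-cong eq eq′ .at n = cong₂ ℚ._+_ (eq .at n) (eq′ .at n)

    ⊕-assoc : ∀ x y z → (x ⊕ y) ⊕ z ≐ x ⊕ (y ⊕ z)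
    ⊕-assoc x y z .at n = ℚ.+-assoc (seq x n) (seq y n) (seq z n)

    ⊕-comm : ∀ x y → x ⊕ y ≐ y ⊕ x
    ⊕-comm x y .at n = ℚ.+-comm (seq x n) (seq y n)

    ⊕-identityˡ : ∀ x → 0ℝ ⊕ x ≐ x
    ⊕-identityˡ x .at n = ℚ.+-identityˡ (seq x n)

    ⊕-identityʳ : ∀ x → x ⊕ 0ℝ ≐ x
    ⊕-identityʳ x .at n = ℚ.+-identityʳ (seq x n)

  -- If x and y differ by more than their fluctuation at some late index, then
  -- their order is decided there; otherwise they are close at every late index.
  ⋠⇒≽ : ∀ {x y} → ¬ (x ≼ y) → y ≼ x
  ⋠⇒≽ {y} {x} y⋠x .bound ε 0<ε
    with M , hx ← cauchy x (half (half ε)) (half>0 (half>0 0<ε))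
       | N , hy ← cauchy y (half (half ε)) (half>0 (half>0 0<ε)) = k , late
    where
    open ℚ.≤-Reasoning
    η : ℚ
    η = half (half ε)
    k : ℕ
    k = M ℕ.⊔ N
    x-close : ∀ m n → k ℕ.≤ m → k ℕ.≤ n → seq x m ℚ.≤ seq x n ℚ.+ η
    x-close m n ≤m ≤n = close⇒≤ (hx m n (ℕ.m⊔n≤o⇒m≤o M N ≤m) (ℕ.m⊔n≤o⇒m≤o M N ≤n))
    y-close : ∀ m n → k ℕ.≤ m → k ℕ.≤ n → seq y m ℚ.≤ seq y n ℚ.+ η
    y-close m n ≤m ≤n = close⇒≤ (hy m n (ℕ.m⊔n≤o⇒n≤o M N ≤m) (ℕ.m⊔n≤o⇒n≤o M N ≤n))
    late : ∀ n → k ℕ.≤ n → seq x n ℚ.≤ seq y n ℚ.+ ε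
    late n ≤n with seq x k ℚ.≤? seq y k ℚ.+ (η ℚ.+ η)
    ... | yes near = begin
      seq x n                                 ≤⟨ x-close n k ≤n ℕ.≤-refl ⟩
      seq x k ℚ.+ η                           ≤⟨ ℚ.+-monoˡ-≤ η near ⟩
      (seq y k ℚ.+ (η ℚ.+ η)) ℚ.+ η           ≤⟨ ℚ.+-monoˡ-≤ η (ℚ.+-monoˡ-≤ (η ℚ.+ η) (y-close k n ℕ.≤-refl ≤n)) ⟩
      ((seq y n ℚ.+ η) ℚ.+ (η ℚ.+ η)) ℚ.+ η   ≡⟨ solve 2 (λ y e → ((y :+ e) :+ (e :+ e)) :+ e := y :+ ((e :+ e) :+ (e :+ e))) refl (seq y n) η ⟩
      seq y n ℚ.+ ((η ℚ.+ η) ℚ.+ (η ℚ.+ η))   ≡⟨ cong (λ t → seq y n ℚ.+ (t ℚ.+ t)) (half+half (half ε)) ⟩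
      seq y n ℚ.+ (half ε ℚ.+ half ε)         ≡⟨ cong (seq y n ℚ.+_) (half+half ε) ⟩
      seq y n ℚ.+ ε                           ∎
    ... | no far = ⊥-elim (y⋠x (wrap λ ε′ 0<ε′ → k , λ m ≤m →
      ℚ.≤-trans (+-cancelʳ-≤ η (begin
        seq y m ℚ.+ η             ≤⟨ ℚ.+-monoˡ-≤ η (y-close m k ≤m ℕ.≤-refl) ⟩
        (seq y k ℚ.+ η) ℚ.+ η     ≡⟨ ℚ.+-assoc (seq y k) η η ⟩
        seq y k ℚ.+ (η ℚ.+ η)     ≤⟨ ℚ.<⇒≤ (ℚ.≰⇒> far) ⟩
        seq x k                   ≤⟨ x-close k m ℕ.≤-refl ≤m ⟩
        seq x m ℚ.+ η             ∎)) (p≤p+ε (seq x m) 0<ε′)))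

  <⇒≼ : ∀ {x y} → x < y → x ≼ y
  <⇒≼ {x} {y} (δ , 0<δ , N , h) .bound ε 0<ε = N , λ n ≤n →
    ℚ.≤-trans (p≤p+ε (seq x n) 0<δ) (ℚ.≤-trans (h n ≤n) (p≤p+ε (seq y n) 0<ε))

  -- At a common late index, `x + δ ≤ y ≤ x + δ/2`.
  <⇒⋡ : ∀ {x y} → x < y → ¬ (y ≼ x)
  <⇒⋡ {x} {y} (δ , 0<δ , M , h) y≼x with N , h′ ← y≼x .bound (half δ) (half>0 0<δ) =
    ℚ.<-irrefl refl (begin-strict
      seq x k ℚ.+ half δ                   ≡⟨ ℚ.+-identityʳ _ ⟨
      (seq x k ℚ.+ half δ) ℚ.+ 0ℚ          <⟨ ℚ.+-monoʳ-< (seq x k ℚ.+ half δ) (half>0 0<δ) ⟩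
      (seq x k ℚ.+ half δ) ℚ.+ half δ      ≡⟨ ℚ.+-assoc (seq x k) (half δ) (half δ) ⟩
      seq x k ℚ.+ (half δ ℚ.+ half δ)      ≡⟨ cong (seq x k ℚ.+_) (half+half δ) ⟩
      seq x k ℚ.+ δ                        ≤⟨ h k (ℕ.m≤m⊔n M N) ⟩
      seq y k                              ≤⟨ h′ k (ℕ.m≤n⊔m M N) ⟩
      seq x k ℚ.+ half δ                   ∎)
    where
    open ℚ.≤-Reasoning
    k : ℕ
    k = M ℕ.⊔ N

  ≐-isEquivalence : IsEquivalence _≐_
  ≐-isEquivalence = record
    { refl  = wrap λ _ → refl
    ; sym   = λ eq → wrap λ n → sym (eq .at n)
    ; trans = λ eq eq′ → wrap λ n → trans (eq .at n) (eq′ .at n) }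

  -- Taken over termwise equality, where the monoid laws are those of ℚ at each index. It supplies
  -- finite sums that can be split and reindexed.
  ⊕-commutativeMonoid : CommutativeMonoid 0ℓ 0ℓ
  ⊕-commutativeMonoid = record
    { _≈_ = _≐_
    ; _∙_ = _⊕_
    ; ε = 0ℝ
    ; isCommutativeMonoid = record
      { isMonoid = record
        { isSemigroup = record
          { isMagma = record { isEquivalence = ≐-isEquivalence ; ∙-cong = ⊕-cong }
          ; assoc = ⊕-assoc }
        ; identity = ⊕-identityˡ , ⊕-identityʳ }
      ; comm = ⊕-comm } }

  ≼-preorder : Preorder 0ℓ 0ℓ 0ℓ
  ≼-preorder = record
    { _≲_ = _≼_
    ; isPreorder = record
      { isEquivalence = ≐-isEquivalence
      ; reflexive = ≐⇒≼
      ; trans = ≼-trans } }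

  module ≼-Reasoning = PreorderReasoning ≼-preorder

  open Sum ⊕-commutativeMonoid public using (sum; sum-cong-≋; sum-cong-≗; ∑-distrib-+; sum-permute)

  sum-mono-≼ : ∀ {n} {f g : Fin n → ℝ} → (∀ i → f i ≼ g i) → sum f ≼ sum g
  sum-mono-≼ {zero}  f≼g = ≼-refl
  sum-mono-≼ {suc n} f≼g = ⊕-mono-≼ (f≼g zero) (sum-mono-≼ (f≼g ∘ suc))

  sum-nonneg : ∀ {n} {f : Fin n → ℝ} → (∀ i → 0ℝ ≼ f i) → 0ℝ ≼ sum f
  sum-nonneg {zero}  0≼f = ≼-refl
  sum-nonneg {suc n} 0≼f =
    ≼-trans (≐⇒≼ (IsEquivalence.sym ≐-isEquivalence (⊕-identityˡ 0ℝ))) (⊕-mono-≼ (0≼f zero) (sum-nonneg (0≼f ∘ suc)))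

  sum-positive : ∀ {n} .{{_ : NonZero n}} {f : Fin n → ℝ} → (∀ i → 0ℝ < f i) → ¬ (sum f ≼ 0ℝ)
  sum-positive {suc n} {f} 0<f sum≼0 = <⇒⋡ (0<f zero) (begin
    f zero                    ≈⟨ ⊕-identityʳ (f zero) ⟨
    f zero ⊕ 0ℝ               ≲⟨ ⊕-mono-≼ ≼-refl (sum-nonneg (<⇒≼ ∘ 0<f ∘ suc)) ⟩
    f zero ⊕ sum (f ∘ suc)    ≲⟨ sum≼0 ⟩
    0ℝ                        ∎)
    where open ≼-Reasoning

  -- Neither `Q` nor the order of reals is decided, so a maximum is found only under double
  -- negation. This suffices for deriving a contradiction.
  maximum : ∀ {n} (Q : Pred (Fin n) 0ℓ) (g : Fin n → ℝ) →
            ¬ ¬ ((∀ i → ¬ Q i) ⊎ ∃ λ i → Q i × ∀ j → Q j → g j ≼ g i)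
  maximum {zero}  Q g k = k (inj₁ λ ())
  maximum {suc n} Q g k = ¬¬-excluded-middle λ where
    (no ¬Q0) → maximum (Q ∘ suc) (g ∘ suc) λ where
      (inj₁ none)          → k (inj₁ λ { zero → ¬Q0 ; (suc i) → none i })
      (inj₂ (i , Qi , ub)) → k (inj₂ (suc i , Qi , λ { zero Q0 → ⊥-elim (¬Q0 Q0) ; (suc j) → ub j }))
    (yes Q0) → maximum (Q ∘ suc) (g ∘ suc) λ where
      (inj₁ none)          → k (inj₂ (zero , Q0 , λ { zero _ → ≼-refl ; (suc j) Qj → ⊥-elim (none j Qj) }))
      (inj₂ (i , Qi , ub)) → ¬¬-excluded-middle λ where
        (yes g0≼) → k (inj₂ (suc i , Qi , λ { zero _ → g0≼ ; (suc j) → ub j }))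
        (no g0⋠)  → k (inj₂ (zero , Q0 , λ where
          zero    _  → ≼-refl
          (suc j) Qj → ≼-trans (ub j Qj) (⋠⇒≽ g0⋠)))

-- Injections of a finite set into itself.

iterate-+ : ∀ {A : Set} (f : A → A) x m n → iterate f x (m ℕ.+ n) ≡ iterate f (iterate f x m) n
iterate-+ f x zero    n = refl
iterate-+ f x (suc m) n = iterate-+ f (f x) m n

iterate-injective : ∀ {A : Set} {f : A → A} → Injective _≡_ _≡_ f → ∀ n {x y} →
                    iterate f x n ≡ iterate f y n → x ≡ y
iterate-injective inj zero    eq = eq
iterate-injective inj (suc n) eq = inj (iterate-injective inj n eq)

-- Two of the first `p + 1` iterates agree; injectivity strips off the iterations common to both.
iterate-returns : ∀ {p} {f : Fin p → Fin p} → Injective _≡_ _≡_ f → ∀ x →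
                  ∃ λ k → iterate f (f x) k ≡ x
iterate-returns {p} {f} inj x
  with i , j , i<j , eq ← Fin.pigeonhole (ℕ.n<1+n p) (λ (i : Fin (suc p)) → iterate f x (toℕ i))
  with k , i+k≡j ← ℕ.m≤n⇒∃[o]m+o≡n i<j =
    k , sym (iterate-injective inj (toℕ i) (begin
      iterate f x (toℕ i)                    ≡⟨ eq ⟩
      iterate f x (toℕ j)                    ≡⟨ cong (iterate f x) (trans (sym i+k≡j) (cong suc (ℕ.+-comm (toℕ i) k))) ⟩
      iterate f x (suc k ℕ.+ toℕ i)          ≡⟨ iterate-+ f x (suc k) (toℕ i) ⟩
      iterate f (iterate f (f x) k) (toℕ i)  ∎))
  where open ≡-Reasoning

-- Some iterate of `f` leads from `f x` back to `x`, and iterating `f` does not leave `S`.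
closed-under-inverse : ∀ {p} {f : Fin p → Fin p} → Injective _≡_ _≡_ f → (S : Pred (Fin p) 0ℓ) →
                       (∀ {x} → S x → S (f x)) → ∀ {x} → S (f x) → S x
closed-under-inverse {p} {f} inj S closed {x} fx∈S with k , eq ← iterate-returns inj x =
  subst S eq (closed* k fx∈S)
  where
  closed* : ∀ k {y} → S y → S (iterate f y k)
  closed* zero    y∈S = y∈S
  closed* (suc k) y∈S = closed* k (closed y∈S)

-- Residues and small constants modulo `p`.

module Arithmetic (p : ℕ) .{{_ : NonZero p}} (p-prime : Prime p) (p>5 : p > 5)
  (-1∈R : Residues.QR p (Residues.-_ p (Residues.⟦_⟧ p 1)))
  (2∈N : Residues.QNR p (Residues.⟦_⟧ p 2)) (3∈N : Residues.QNR p (Residues.⟦_⟧ p 3)) where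

  open Residues p
  open Paley p using (PaleyPath; midpoint; three)
  open Field p-prime
  open CommutativeRing commutativeRing public using (distribʳ; +-identityʳ; -‿inverseʳ)
  private
    module Solver = SemiringSolver (CommutativeRing.commutativeSemiring commutativeRing)
  open Solver using (solve; _:=_; _:+_)
  open ≡-Reasoning

  infixl 7 _·_
  _·_ : ℕ → 𝔽 → 𝔽
  m · x = ⟦ m ⟧ * x

  ·-assoc : ∀ m n x → m · (n · x) ≡ (m ℕ.* n) · x
  ·-assoc m n x = trans (sym (*-assoc ⟦ m ⟧ ⟦ n ⟧ x)) (cong (_* x) (⟦*⟧ m n))

  ·-distrib : ∀ m n x → m · x + n · x ≡ (m ℕ.+ n) · x
  ·-distrib m n x = trans (sym (distribʳ x ⟦ m ⟧ ⟦ n ⟧)) (cong (_* x) (⟦+⟧ m n))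

  infix 4 _≡±_
  _≡±_ : 𝔽 → 𝔽 → Set
  x ≡± y = x ≡ y ⊎ x ≡ - y

  ·-congˡ-± : ∀ m {x y} → x ≡± y → m · x ≡± m · y
  ·-congˡ-± m     (inj₁ eq) = inj₁ (cong (m ·_) eq)
  ·-congˡ-± m {x} {y} (inj₂ eq) = inj₂ (begin
    m · x        ≡⟨ cong (m ·_) eq ⟩
    ⟦ m ⟧ * - y  ≡⟨ *-comm ⟦ m ⟧ (- y) ⟩
    - y * ⟦ m ⟧  ≡⟨ -‿distribˡ-* y ⟦ m ⟧ ⟨
    - (y * ⟦ m ⟧)  ≡⟨ cong (-_) (*-comm y ⟦ m ⟧) ⟩
    - (m · y)    ∎)

  ±-join : ∀ {x y z} → x ≡± y → x ≡± z → y ≡± z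
  ±-join (inj₁ refl) x±z = x±z
  ±-join {y = y} (inj₂ refl) (inj₁ eq) = inj₂ (trans (sym (-‿involutive y)) (cong (-_) eq))
  ±-join (inj₂ refl) (inj₂ eq) = inj₁ (-‿injective eq)

  NonZeroMod : Pred ℕ 0ℓ
  NonZeroMod n = ⟦ n ⟧ ≢ ⟦ 0 ⟧

  infixr 7 _⊗_
  _⊗_ : ∀ {m n} → NonZeroMod m → NonZeroMod n → NonZeroMod (m ℕ.* n)
  _⊗_ {m} {n} m≢0 n≢0 eq = *-nonzero m≢0 n≢0 (trans (⟦*⟧ m n) eq)

  -- The difference of the two constants is `k` and their sum is `m + k + m`. Every comparison of
  -- constants up to sign thus comes down to two integers being nonzero modulo `p`.
  distinct-± : ∀ m k → NonZeroMod k → NonZeroMod (m ℕ.+ k ℕ.+ m) → ¬ (⟦ m ℕ.+ k ⟧ ≡± ⟦ m ⟧)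
  distinct-± m k k≢0 _ (inj₁ eq) = k≢0 (+-cancelˡ ⟦ m ⟧ ⟦ k ⟧ ⟦ 0 ⟧
    (trans (⟦+⟧ m k) (trans eq (sym (+-identityʳ ⟦ m ⟧)))))
  distinct-± m k _ 2m+k≢0 (inj₂ eq) = 2m+k≢0 (begin
    ⟦ m ℕ.+ k ℕ.+ m ⟧      ≡⟨ ⟦+⟧ (m ℕ.+ k) m ⟨
    ⟦ m ℕ.+ k ⟧ + ⟦ m ⟧    ≡⟨ cong (_+ ⟦ m ⟧) eq ⟩
    - ⟦ m ⟧ + ⟦ m ⟧        ≡⟨ trans (+-comm _ _) (-‿inverseʳ ⟦ m ⟧) ⟩
    ⟦ 0 ⟧                  ∎)

  -- Eliminates `v` by cross-multiplication: after scaling by `c` and `d` the two left-hand sides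
  -- coincide.
  combine-± : ∀ c d {a b m n} v → c ℕ.* a ≡ d ℕ.* b → a · v ≡± ⟦ m ⟧ → b · v ≡± ⟦ n ⟧ →
              ⟦ c ℕ.* m ⟧ ≡± ⟦ d ℕ.* n ⟧
  combine-± c d {a} {b} {m} {n} v ca≡db av bv =
    subst₂ _≡±_ (⟦*⟧ c m) (⟦*⟧ d n) (±-join (·-congˡ-± c av)
      (subst (_≡± d · ⟦ n ⟧) (begin
        d · (b · v)    ≡⟨ ·-assoc d b v ⟩
        (d ℕ.* b) · v  ≡⟨ cong (_· v) ca≡db ⟨
        (c ℕ.* a) · v  ≡⟨ ·-assoc c a v ⟨
        c · (a · v)    ∎) (·-congˡ-± d bv)))

  private
    wrapped : ∀ {n} m k → ⟦ n ⟧ ≡ ⟦ 0 ⟧ → ⟦ m ℕ.+ k ℕ.* n ⟧ ≡ ⟦ m ⟧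
    wrapped {n} m k n≡0 = begin
      ⟦ m ℕ.+ k ℕ.* n ⟧    ≡⟨ ⟦+⟧ m (k ℕ.* n) ⟨
      ⟦ m ⟧ + ⟦ k ℕ.* n ⟧  ≡⟨ cong (⟦ m ⟧ +_) (trans (sym (⟦*⟧ k n)) (trans (cong (⟦ k ⟧ *_) n≡0) (zeroʳ ⟦ k ⟧))) ⟩
      ⟦ m ⟧ + ⟦ 0 ⟧        ≡⟨ +-identityʳ ⟦ m ⟧ ⟩
      ⟦ m ⟧                ∎

  1≢0 : NonZeroMod 1
  1≢0 = ⟦⟧≢0 (ℕ.<-trans (s≤s (s≤s z≤n)) p>5)

  2≢0 : NonZeroMod 2
  2≢0 = proj₁ 2∈N

  3≢0 : NonZeroMod 3
  3≢0 = proj₁ 3∈N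

  5≢0 : NonZeroMod 5
  5≢0 = ⟦⟧≢0 p>5

  -- Modulo 7 one has `2 = 3²`, modulo 11 `3 = 5²`, and modulo 13 `3 = 4²`; each contradicts 2 or 3
  -- being a non-residue.
  7≢0 : NonZeroMod 7
  7≢0 eq = proj₂ 2∈N (⟦ 3 ⟧ , trans (⟦*⟧ 3 3) (wrapped 2 1 eq))

  11≢0 : NonZeroMod 11
  11≢0 eq = proj₂ 3∈N (⟦ 5 ⟧ , trans (⟦*⟧ 5 5) (wrapped 3 2 eq))

  13≢0 : NonZeroMod 13
  13≢0 eq = proj₂ 3∈N (⟦ 4 ⟧ , trans (⟦*⟧ 4 4) (wrapped 3 1 eq))

  QR-* : ∀ {x y} → QR x → QR y → QR (x * y)
  QR-* (x≢0 , a , a²≡x) (y≢0 , b , b²≡y) = *-nonzero x≢0 y≢0 , a * b ,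
    trans (sym (square*square a b)) (cong₂ _*_ a²≡x b²≡y)

  QR-cancelˡ : ∀ {x y} → QR x → QR (x * y) → QR y
  QR-cancelˡ {x} {y} (x≢0 , a , a²≡x) (xy≢0 , b , b²≡xy) =
    (λ { refl → xy≢0 (zeroʳ x) }) ,
    square-cancelˡ (λ { refl → x≢0 (trans (sym a²≡x) (zeroʳ _)) })
      (trans b²≡xy (cong (_* y) (sym a²≡x)))

  QNR-*-QR : ∀ {x y} → QNR x → QR y → QNR (x * y)
  QNR-*-QR {x} {y} (x≢0 , ¬sq) (y≢0 , b , b²≡y) = *-nonzero x≢0 y≢0 , λ (c , c²≡xy) →
    ¬sq (square-cancelˡ (λ { refl → y≢0 (trans (sym b²≡y) (zeroʳ _)) })
      (trans c²≡xy (trans (*-comm x y) (cong (_* x) (sym b²≡y)))))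

  square∈R : ∀ n → NonZeroMod n → QR ⟦ n ℕ.* n ⟧
  square∈R n n≢0 = n≢0 ⊗ n≢0 , ⟦ n ⟧ , ⟦*⟧ n n

  1∈R : QR ⟦ 1 ⟧
  1∈R = square∈R 1 1≢0

  4∈R : QR ⟦ 4 ⟧
  4∈R = square∈R 2 2≢0

  6∈R : QR ⟦ 6 ⟧
  6∈R = subst QR (⟦*⟧ 2 3) (QNR*QNR (ℕ.<-trans (s≤s (s≤s (s≤s (s≤s z≤n)))) p>5) 2∈N 3∈N)

  -- The residues u such that the path from a to a + 2u is not the one through
  -- the midpoint a + u.
  Exceptional : Pred 𝔽 0ℓ
  Exceptional u = 2 · u ≡± ⟦ 3 ⟧

  exceptional? : ∀ u → Dec (Exceptional u)
  exceptional? u = (2 · u Fin.≟ ⟦ 3 ⟧) ⊎-dec (2 · u Fin.≟ - ⟦ 3 ⟧)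

  exceptional-· : ∀ k {u} → Exceptional (k · u) → (2 ℕ.* k) · u ≡± ⟦ 3 ⟧
  exceptional-· k {u} = subst (_≡± ⟦ 3 ⟧) (·-assoc 2 k u)

  midpointPath : ∀ a {u} → QR u → ¬ Exceptional u →
                 PaleyPath a (a + u + u) (a ∷ a + u ∷ a + u + u ∷ [])
  midpointPath a {u} u∈R ¬exc = midpoint
    (subst QNR (sym diff) (QNR-*-QR 2∈N u∈R))
    (λ eq → ¬exc (inj₁ (trans (sym diff) eq)))
    (λ eq → ¬exc (inj₂ (trans (sym diff) eq)))
    (trans (⟦2⟧*x (a + u)) (solve 2 (λ a u → (a :+ u) :+ (a :+ u) := a :+ ((a :+ u) :+ u)) refl a u))
    where
    diff : (a + u + u) - a ≡ 2 · u
    diff = begin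
      (a + u + u) - a    ≡⟨ cong (_- a) (+-assoc a u u) ⟩
      (a + (u + u)) - a  ≡⟨ xyx⁻¹≈y a (u + u) ⟩
      u + u              ≡⟨ ⟦2⟧*x u ⟨
      2 · u              ∎

  a+n+1 : ∀ a n → a + ⟦ n ⟧ + ⟦ 1 ⟧ ≡ a + ⟦ n ℕ.+ 1 ⟧
  a+n+1 a n = trans (+-assoc a ⟦ n ⟧ ⟦ 1 ⟧) (cong (a +_) (⟦+⟧ n 1))

  a+1+1+1 : ∀ a → a + ⟦ 1 ⟧ + ⟦ 1 ⟧ + ⟦ 1 ⟧ ≡ a + ⟦ 3 ⟧
  a+1+1+1 a = trans (cong (_+ ⟦ 1 ⟧) (a+n+1 a 1)) (a+n+1 a 2)

  -- Each vertex is written as its predecessor plus one, so that the tail of the path is literally a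
  -- translate when weights are summed over `a`.
  threePath : ∀ a → let b = a + ⟦ 1 ⟧; c = b + ⟦ 1 ⟧; d = c + ⟦ 1 ⟧ in
              PaleyPath a d (a ∷ b ∷ c ∷ d ∷ [])
  threePath a = subst₂ (λ c d → PaleyPath a d (a ∷ a + ⟦ 1 ⟧ ∷ c ∷ d ∷ []))
    (sym (a+n+1 a 1)) (sym (a+1+1+1 a)) (three (xyx⁻¹≈y a ⟦ 3 ⟧))

-- Reductions as two-colourings of the vertices.

module _ {G : Graph} {S : PathSystem G} (r : Reduction S) where
  open Graph G using (V)
  open PathSystem S using (𝒫)
  open Reduction r

  side : V → Bool
  side v = [ (λ _ → true) , (λ _ → false) ] (cover v)

  A⇒side : ∀ {v} → A v → side v ≡ true
  A⇒side {v} v∈A with cover v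
  ... | inj₁ _   = refl
  ... | inj₂ v∈B = ⊥-elim (disjoint v∈A v∈B)

  B⇒side : ∀ {v} → B v → side v ≡ false
  B⇒side {v} v∈B with cover v
  ... | inj₁ v∈A = ⊥-elim (disjoint v∈A v∈B)
  ... | inj₂ _   = refl

  -- Merges the two closure conditions into one statement about colours, the form used in the run
  -- argument.
  side-closed : ∀ {u v xs} → side u ≡ side v → 𝒫 u v xs → All (λ x → side x ≡ side u) xs
  side-closed {u} {v} eq P with cover u | cover v
  ... | inj₁ u∈A | inj₁ v∈A = All.map A⇒side (A-closed u∈A v∈A P)
  ... | inj₂ u∈B | inj₂ v∈B = All.map B⇒side (B-closed u∈B v∈B P)
  ... | inj₁ _   | inj₂ _   with () ← eq
  ... | inj₂ _   | inj₁ _   with () ← eq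

-- Irreducibility.

module Irreducibility (p : ℕ) .{{_ : NonZero p}} (p-prime : Prime p) (p>5 : p > 5)
  (-1∈R : Residues.QR p (Residues.-_ p (Residues.⟦_⟧ p 1)))
  (2∈N : Residues.QNR p (Residues.⟦_⟧ p 2)) (3∈N : Residues.QNR p (Residues.⟦_⟧ p 3)) where

  open Residues p
  open Arithmetic p p-prime p>5 -1∈R 2∈N 3∈N
  open Paley p using (paleySystem)

  Regular : ℕ → Set
  Regular d = QR ⟦ d ⟧ × ¬ Exceptional ⟦ d ⟧

  -- Whether a given `d` is exceptional depends on `p`, so two candidates are offered that cannot
  -- both be exceptional.
  one-regular : ∀ {d e} → QR ⟦ d ⟧ → QR ⟦ e ⟧ →
                ¬ (Exceptional ⟦ d ⟧ × Exceptional ⟦ e ⟧) → Regular d ⊎ Regular e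
  one-regular {d} {e} d∈R e∈R ¬both with exceptional? ⟦ d ⟧ | exceptional? ⟦ e ⟧
  ... | no ¬exc-d | _         = inj₁ (d∈R , ¬exc-d)
  ... | yes _     | no ¬exc-e = inj₂ (e∈R , ¬exc-e)
  ... | yes exc-d | yes exc-e = ⊥-elim (¬both (exc-d , exc-e))

  exceptional-ℕ : ∀ k s → Exceptional ⟦ k ℕ.* s ⟧ → (2 ℕ.* k) · ⟦ s ⟧ ≡± ⟦ 3 ⟧
  exceptional-ℕ k s exc = exceptional-· k (subst Exceptional (sym (⟦*⟧ k s)) exc)

  -- `t` is a power of two, starting at 1 for `K = 5` and doubled each time `K` passes `16 t²`.
  powers-of-two : ∀ K → 4 ℕ.< K →
    ∃ λ t → NonZeroMod t × 4 ℕ.* (t ℕ.* t) ℕ.< K × K ℕ.≤ 16 ℕ.* (t ℕ.* t)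
  powers-of-two (suc K) (s≤s 4≤K) with ℕ.m≤n⇒m<n∨m≡n 4≤K
  ... | inj₂ refl = 1 , 1≢0 , ℕ.≤-refl , ℕ.m≤m+n 5 11
  ... | inj₁ 4<K with t , t≢0 , 4s<K , K≤16s ← powers-of-two K 4<K | ℕ.m≤n⇒m<n∨m≡n K≤16s
  ... | inj₁ K<16s = t , t≢0 , ℕ.<-trans 4s<K (ℕ.n<1+n K) , K<16s
  ... | inj₂ K≡16s = 2 ℕ.* t , 2≢0 ⊗ t≢0 ,
    s≤s (ℕ.≤-reflexive (trans (lemma₁ t) (sym K≡16s))) ,
    ℕ.≤-trans (ℕ.+-mono-≤ (ℕ.≤-trans (s≤s z≤n) 4<K) (ℕ.≤-reflexive K≡16s))
      (ℕ.≤-trans (ℕ.+-monoˡ-≤ (16 ℕ.* (t ℕ.* t)) (ℕ.≤-trans K≤16s (ℕ.m≤m+n _ (32 ℕ.* (t ℕ.* t)))))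
        (ℕ.≤-reflexive (lemma₂ t)))
    where
    lemma₁ : ∀ t → 4 ℕ.* (2 ℕ.* t ℕ.* (2 ℕ.* t)) ≡ 16 ℕ.* (t ℕ.* t)
    lemma₁ = solve-∀
    lemma₂ : ∀ t → 16 ℕ.* (t ℕ.* t) ℕ.+ 32 ℕ.* (t ℕ.* t) ℕ.+ 16 ℕ.* (t ℕ.* t) ≡ 16 ℕ.* (2 ℕ.* t ℕ.* (2 ℕ.* t))
    lemma₂ = solve-∀

  QR-ℕ : ∀ {k} t → NonZeroMod t → QR ⟦ k ⟧ → QR ⟦ k ℕ.* (t ℕ.* t) ⟧
  QR-ℕ {k} t t≢0 k∈R = subst QR (⟦*⟧ k (t ℕ.* t)) (QR-* k∈R (square∈R t t≢0))

  InRange : ℕ → ℕ → Set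
  InRange K d = K ℕ.< d ℕ.+ d × d ℕ.+ d ℕ.< K ℕ.+ K ℕ.+ K

  4-regular : Regular 4
  4-regular = 4∈R , λ exc → distinct-± 3 5 5≢0 11≢0 (subst (_≡± ⟦ 3 ⟧) (⟦*⟧ 2 4) exc)

  -- For `K` equal to 3 or 4 take `d = 4`. Beyond that, with `s` the power of four from
  -- `powers-of-two`, the candidates are `4s`, `6s` below `8s`, then `6s`, `9s` below `12s`, then
  -- `9s`, `16s`. Were both exceptional, eliminating `s` would give `9 = ±6` in the first two cases
  -- and `48 = ±27` in the last.
  regular-step : ∀ K → 2 ℕ.< K → ∃ λ d → Regular d × InRange K d
  regular-step K 2<K with ℕ.m≤n⇒m<n∨m≡n 2<K
  ... | inj₂ refl = 4 , 4-regular , ℕ.m≤m+n 4 4 , ℕ.≤-refl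
  ... | inj₁ 3<K with ℕ.m≤n⇒m<n∨m≡n 3<K
  ... | inj₂ refl = 4 , 4-regular , ℕ.m≤m+n 5 3 , ℕ.m≤m+n 9 3
  ... | inj₁ 4<K with t , t≢0 , 4s<K , K≤16s ← powers-of-two K 4<K = choose
    where
    s : ℕ
    s = t ℕ.* t

    s∈R : ∀ {k} → QR ⟦ k ⟧ → QR ⟦ k ℕ.* s ⟧
    s∈R = QR-ℕ t t≢0

    either : ∀ {d e} → InRange K d → InRange K e → Regular d ⊎ Regular e →
             ∃ λ d → Regular d × InRange K d
    either {d} in-d in-e (inj₁ reg) = d , reg , in-d
    either {e = e} in-d in-e (inj₂ reg) = e , reg , in-e

    9≢±6 : ¬ (⟦ 9 ⟧ ≡± ⟦ 6 ⟧)
    9≢±6 = distinct-± 6 3 3≢0 (3≢0 ⊗ 5≢0)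

    0<s : 0 ℕ.< s
    0<s = ℕ.*-cancelˡ-< 16 0 s (ℕ.<-≤-trans (ℕ.≤-<-trans z≤n 4<K) K≤16s)

    range : ∀ a b c → a ℕ.* s ℕ.< K → K ℕ.< b ℕ.* s →
            {T (c ℕ.+ c ℕ.≤ᵇ a ℕ.+ a ℕ.+ a)} → {T (b ℕ.≤ᵇ c ℕ.+ c)} → InRange K (c ℕ.* s)
    range a b c as<K K<bs {2c≤3a} {b≤2c} =
      subst (K ℕ.<_) (ℕ.*-distribʳ-+ s c c) (ℕ.<-≤-trans K<bs (ℕ.*-monoˡ-≤ s (ℕ.≤ᵇ⇒≤ b (c ℕ.+ c) b≤2c))) ,
      subst (ℕ._< K ℕ.+ K ℕ.+ K) (ℕ.*-distribʳ-+ s c c)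
        (ℕ.≤-<-trans (ℕ.*-monoˡ-≤ s (ℕ.≤ᵇ⇒≤ (c ℕ.+ c) (a ℕ.+ a ℕ.+ a) 2c≤3a))
          (subst (ℕ._< K ℕ.+ K ℕ.+ K) (lemma a s) (ℕ.+-mono-< (ℕ.+-mono-< as<K as<K) as<K)))
      where
      lemma : ∀ a s → a ℕ.* s ℕ.+ a ℕ.* s ℕ.+ a ℕ.* s ≡ (a ℕ.+ a ℕ.+ a) ℕ.* s
      lemma = solve-∀

    K<17s : K ℕ.< 17 ℕ.* s
    K<17s = ℕ.≤-<-trans K≤16s (ℕ.m<n+m (16 ℕ.* s) 0<s)

    -- `range` wants strict bounds, while the case split gives weak ones. Lowering the coefficient
    -- by one still leaves enough slack.
    step-down : ∀ a → ¬ (K ℕ.< suc a ℕ.* s) → a ℕ.* s ℕ.< K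
    step-down a K≮ = ℕ.<-≤-trans (ℕ.m<n+m (a ℕ.* s) 0<s) (ℕ.≮⇒≥ K≮)

    choose : ∃ λ d → Regular d × InRange K d
    choose with K ℕ.<? 8 ℕ.* s
    ... | yes K<8s = either (range 4 8 4 4s<K K<8s) (range 4 8 6 4s<K K<8s)
      (one-regular (s∈R 4∈R) (s∈R 6∈R)
        λ (e₁ , e₂) → 9≢±6 (combine-± 3 2 ⟦ s ⟧ refl (exceptional-ℕ 4 s e₁) (exceptional-ℕ 6 s e₂)))
    ... | no K≮8s with K ℕ.<? 12 ℕ.* s
    ... | yes K<12s = either (range 7 12 6 (step-down 7 K≮8s) K<12s) (range 7 12 9 (step-down 7 K≮8s) K<12s)
      (one-regular (s∈R 6∈R) (s∈R (square∈R 3 3≢0))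
        λ (e₁ , e₂) → 9≢±6 (combine-± 3 2 ⟦ s ⟧ refl (exceptional-ℕ 6 s e₁) (exceptional-ℕ 9 s e₂)))
    ... | no K≮12s = either (range 11 17 9 (step-down 11 K≮12s) K<17s) (range 11 17 16 (step-down 11 K≮12s) K<17s)
      (one-regular (s∈R (square∈R 3 3≢0)) (s∈R (square∈R 4 (2≢0 ⊗ 2≢0)))
        λ (e₁ , e₂) → distinct-± 27 21 (3≢0 ⊗ 7≢0) (3≢0 ⊗ 5≢0 ⊗ 5≢0)
          (combine-± 16 9 ⟦ s ⟧ refl (exceptional-ℕ 9 s e₁) (exceptional-ℕ 16 s e₂)))

  irreducible : Irreducible (paleySystem p-prime -1∈R 2∈N 3∈N)
  irreducible r with a , a∈A ← Reduction.A-nonempty r | b , b∈B ← Reduction.B-nonempty r =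
    true≢false (begin
      true        ≡⟨ A⇒side r a∈A ⟨
      side r a    ≡⟨ constant-side a ⟩
      f 0         ≡⟨ constant-side b ⟨
      side r b    ≡⟨ B⇒side r b∈B ⟩
      false       ∎)
    where
    open ≡-Reasoning
    true≢false : true ≢ false
    true≢false ()

    f : ℕ → Bool
    f n = side r ⟦ n ⟧

    periodic : ∀ n → f (n ℕ.+ p) ≡ f n
    periodic n = cong (side r) (begin
      ⟦ n ℕ.+ p ⟧    ≡⟨ ⟦+⟧ n p ⟨
      ⟦ n ⟧ + ⟦ p ⟧  ≡⟨ cong (⟦ n ⟧ +_) ⟦p⟧ ⟩
      ⟦ n ⟧ + ⟦ 0 ⟧  ≡⟨ +-identityʳ ⟦ n ⟧ ⟩
      ⟦ n ⟧          ∎)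

    open Runs.Colouring f p (ℕ.≤-<-trans z≤n p>5) periodic

    regular⇒midpoint : ∀ {d} → Regular d → Midpoint d
    regular⇒midpoint {d} (d∈R , ¬exc) x same =
      trans (cong (side r) (sym (⟦+⟧ x d))) (All.head (All.tail (side-closed r
        (subst (λ z → f x ≡ side r z) (sym (trans (cong (_+ ⟦ d ⟧) (⟦+⟧ x d)) (⟦+⟧ (x ℕ.+ d) d))) same)
        (midpointPath ⟦ x ⟧ d∈R ¬exc))))

    1-regular : Regular 1
    1-regular = square∈R 1 1≢0 , λ exc →
      distinct-± 2 1 1≢0 5≢0 (±-join exc (inj₁ (⟦*⟧ 2 1)))

    -- Serves `K = 2`, where `2 < 2d < 6` leaves only the non-residue `d = 2`.
    three-rule : ∀ x → f x ≡ f (suc x ℕ.+ 2) → f (suc x) ≡ f x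
    three-rule x same = trans (cong (side r) (sym +1)) (All.head (All.tail (side-closed r
      (subst (λ z → f x ≡ side r z) (sym +3) same) (threePath ⟦ x ⟧))))
      where
      +1 : ⟦ x ⟧ + ⟦ 1 ⟧ ≡ ⟦ suc x ⟧
      +1 = trans (⟦+⟧ x 1) (cong ⟦_⟧ (ℕ.+-comm x 1))
      +3 : ⟦ x ⟧ + ⟦ 1 ⟧ + ⟦ 1 ⟧ + ⟦ 1 ⟧ ≡ ⟦ suc x ℕ.+ 2 ⟧
      +3 = begin
        ⟦ x ⟧ + ⟦ 1 ⟧ + ⟦ 1 ⟧ + ⟦ 1 ⟧  ≡⟨ cong (λ z → z + ⟦ 1 ⟧ + ⟦ 1 ⟧) +1 ⟩
        ⟦ suc x ⟧ + ⟦ 1 ⟧ + ⟦ 1 ⟧      ≡⟨ cong (_+ ⟦ 1 ⟧) (⟦+⟧ (suc x) 1) ⟩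
        ⟦ suc x ℕ.+ 1 ⟧ + ⟦ 1 ⟧        ≡⟨ ⟦+⟧ (suc x ℕ.+ 1) 1 ⟩
        ⟦ suc x ℕ.+ 1 ℕ.+ 1 ⟧          ≡⟨ cong ⟦_⟧ (ℕ.+-assoc (suc x) 1 1) ⟩
        ⟦ suc x ℕ.+ 2 ⟧                ∎

    runs₁ : RunsOf 1
    runs₁ x bd zero    i<1 = cong f (ℕ.+-identityʳ (suc x))
    runs₁ x bd (suc i) (s≤s ())

    runs₂ : RunsOf 2
    runs₂ = lengthen runs₁ (regular⇒midpoint 1-regular) ℕ.≤-refl ℕ.≤-refl

    runs₃ : RunsOf 3
    runs₃ x bd i i<3 with ℕ.m≤n⇒m<n∨m≡n i<3
    ... | inj₁ (s≤s i<2) = runs₂ x bd i i<2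
    ... | inj₂ refl with f (suc x ℕ.+ 2) Bool.≟ f (suc x)
    ... | yes eq = eq
    -- With two colours, `suc x + 2` differing from `suc x` agrees with `x`, so the path between
    -- them is monochromatic and `x` is no boundary.
    ... | no ≢ = ⊥-elim (bd (sym (three-rule x (sym (≢-agree bd ≢)))))

    runs : ∀ k → RunsOf (k ℕ.+ 3)
    runs zero    = runs₃
    runs (suc k) = let d , regular , K<2d , 2d<3K = regular-step (k ℕ.+ 3) (ℕ.m≤n+m 3 k)
                   in lengthen (runs k) (regular⇒midpoint regular) K<2d 2d<3K

    constant-side : ∀ v → side r v ≡ f 0
    constant-side v = trans (cong (side r) (sym (⟦toℕ⟧ v)))
      -- From runs of length 3, `p - 3` lengthenings reach a full period.
      (constant (subst RunsOf (ℕ.m∸n+n≡m 3≤p) (runs (p ℕ.∸ 3))) (toℕ v))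
      where
      3≤p : 3 ℕ.≤ p
      3≤p = ℕ.≤-trans (ℕ.m≤m+n 3 3) p>5

-- Non-metrizability.

module NonMetrizability (p : ℕ) .{{_ : NonZero p}} (p-prime : Prime p) (p>5 : p > 5)
  (-1∈R : Residues.QR p (Residues.-_ p (Residues.⟦_⟧ p 1)))
  (2∈N : Residues.QNR p (Residues.⟦_⟧ p 2)) (3∈N : Residues.QNR p (Residues.⟦_⟧ p 3))
  (metrizable : Metrizable (Paley.paleySystem p p-prime -1∈R 2∈N 3∈N)) where

  open Residues p
  open Arithmetic p p-prime p>5 -1∈R 2∈N 3∈N
  open Field p-prime
  open Paley p using (PaleyPath; paleyGraph; step; apart)
  open Weight (proj₁ metrizable)
  open RealProperties
  open IsEquivalence ≐-isEquivalence using () renaming (refl to ≐-refl; sym to ≐-sym; trans to ≐-trans; reflexive to ≐-reflexive)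

  shortest : ∀ {u v xs ys} → PaleyPath u v xs → IsPath (paleyGraph -1∈R) u v ys → total xs ≼ total ys
  shortest P Q = wrap (proj₂ metrizable P Q)

  adjacent : ∀ a {r} → QR r → Graph._~_ (paleyGraph -1∈R) a (a + r)
  adjacent a r∈R = step p-prime -1∈R 2∈N 3∈N refl r∈R

  twoStepPath : ∀ a {x y} → QR x → QR y → x + y ≢ ⟦ 0 ⟧ →
                IsPath (paleyGraph -1∈R) a (a + x + y) (a ∷ a + x ∷ a + x + y ∷ [])
  twoStepPath a {x} {y} x∈R y∈R x+y≢0 =
    adjacent a x∈R ∷ adjacent (a + x) y∈R ∷ [-] ,
    (ne refl (proj₁ x∈R) ∷ ne (sym (+-assoc a x y)) x+y≢0 ∷ []) ∷
    (ne refl (proj₁ y∈R) ∷ []) ∷ [] ∷ []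
    where
    ne : ∀ {x y d} → x + d ≡ y → d ≢ ⟦ 0 ⟧ → x ≢ y
    ne = apart p-prime -1∈R 2∈N 3∈N

  total₂ : ∀ a b c → total (a ∷ b ∷ c ∷ []) ≐ w a b ⊕ w b c
  total₂ a b c = ≐-trans
    (≐-reflexive (trans (+≡⊕ _ _) (cong (w a b ⊕_) (+≡⊕ _ _))))
    (⊕-cong ≐-refl (⊕-identityʳ (w b c)))

  translation : 𝔽 → Permutation′ p
  translation c = permutation (_+ c) (_- c) (//-rightDividesˡ c)
    (λ a → trans (cong (_- c) (+-comm a c)) (xyx⁻¹≈y c a))

  sum-translate : ∀ c (f : 𝔽 → Real.ℝ) → sum f ≐ sum (λ a → f (a + c))
  sum-translate c f = sum-permute f (translation c)

  -- The average over translations, multiplied by `p` to avoid division.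
  g : 𝔽 → Real.ℝ
  g r = sum λ a → w a (a + r)

  -- Reverse every edge, then translate by `r`.
  g-neg : ∀ {r} → QR r → g (- r) ≼ g r
  g-neg {r} r∈R = begin
    sum (λ a → w a (a - r))              ≲⟨ sum-mono-≼ (λ a → wrap (proj₁ (w-sym (adjacent a (QR-neg -1∈R r∈R))))) ⟩
    sum (λ a → w (a - r) a)              ≈⟨ sum-translate r _ ⟩
    sum (λ a → w (a + r - r) (a + r))    ≈⟨ ≐-reflexive (sum-cong-≗ λ a → cong (λ b → w b (a + r)) (trans (cong (_- r) (+-comm a r)) (xyx⁻¹≈y r a))) ⟩
    sum (λ a → w a (a + r))              ∎
    where open ≼-Reasoning

  sum-total₂ : ∀ x y → sum (λ a → total (a ∷ a + x ∷ a + x + y ∷ [])) ≐ g x ⊕ g y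
  sum-total₂ x y = begin
    sum (λ a → total (a ∷ a + x ∷ a + x + y ∷ []))        ≈⟨ sum-cong-≋ (λ a → total₂ a (a + x) (a + x + y)) ⟩
    sum (λ a → w a (a + x) ⊕ w (a + x) (a + x + y))       ≈⟨ ∑-distrib-+ (λ a → w a (a + x)) (λ a → w (a + x) (a + x + y)) ⟩
    g x ⊕ sum (λ a → w (a + x) (a + x + y))               ≈⟨ ⊕-cong ≐-refl (sum-translate x (λ a → w a (a + y))) ⟨
    g x ⊕ g y                                             ∎
    where open SetoidReasoning (CommutativeMonoid.setoid ⊕-commutativeMonoid)

  two-step : ∀ {u x y} → QR u → ¬ Exceptional u → QR x → QR y → x + y ≡ 2 · u → g u ⊕ g u ≼ g x ⊕ g y
  two-step {u} {x} {y} u∈R ¬exc x∈R y∈R x+y≡2u = begin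
    g u ⊕ g u                                          ≈⟨ sum-total₂ u u ⟨
    sum (λ a → total (a ∷ a + u ∷ a + u + u ∷ []))     ≲⟨ sum-mono-≼ (λ a → shortest (midpointPath a u∈R ¬exc)
                                                            (subst (λ b → IsPath _ a b (a ∷ a + x ∷ b ∷ [])) (endpoint a) (twoStepPath a x∈R y∈R x+y≢0))) ⟩
    sum (λ a → total (a ∷ a + x ∷ a + u + u ∷ []))     ≈⟨ ≐-reflexive (sum-cong-≗ λ a → cong (λ b → total (a ∷ a + x ∷ b ∷ [])) (endpoint a)) ⟨
    sum (λ a → total (a ∷ a + x ∷ a + x + y ∷ []))     ≈⟨ sum-total₂ x y ⟩
    g x ⊕ g y                                          ∎
    where
    open ≼-Reasoning
    x+y≢0 : x + y ≢ ⟦ 0 ⟧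
    x+y≢0 eq = *-nonzero 2≢0 (proj₁ u∈R) (trans (sym x+y≡2u) eq)
    endpoint : ∀ a → a + x + y ≡ a + u + u
    endpoint a = trans (+-assoc a x y) (trans (cong (a +_) (trans x+y≡2u (⟦2⟧*x u))) (sym (+-assoc a u u)))

  three-step : ∀ {x y} → QR x → QR y → x + y ≡ ⟦ 3 ⟧ → g ⟦ 1 ⟧ ⊕ (g ⟦ 1 ⟧ ⊕ g ⟦ 1 ⟧) ≼ g x ⊕ g y
  three-step {x} {y} x∈R y∈R x+y≡3 = begin
    g ⟦ 1 ⟧ ⊕ (g ⟦ 1 ⟧ ⊕ g ⟦ 1 ⟧)                          ≈⟨ ⊕-cong ≐-refl (sum-total₂ ⟦ 1 ⟧ ⟦ 1 ⟧) ⟨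
    g ⟦ 1 ⟧ ⊕ sum (λ a → total (a ∷ a + ⟦ 1 ⟧ ∷ a + ⟦ 1 ⟧ + ⟦ 1 ⟧ ∷ []))
      -- Once the first edge is split off, the rest is the two-edge path from `a + 1`; summing over
      -- all `a` absorbs the shift.
      ≈⟨ ⊕-cong ≐-refl (sum-translate ⟦ 1 ⟧ (λ a → total (a ∷ a + ⟦ 1 ⟧ ∷ a + ⟦ 1 ⟧ + ⟦ 1 ⟧ ∷ []))) ⟩
    g ⟦ 1 ⟧ ⊕ sum (λ a → total (tail a))                   ≈⟨ ∑-distrib-+ (λ a → w a (a + ⟦ 1 ⟧)) (λ a → total (tail a)) ⟨
    sum (λ a → w a (a + ⟦ 1 ⟧) ⊕ total (tail a))           ≈⟨ sum-cong-≋ (λ a → ≐-reflexive (+≡⊕ (w a (a + ⟦ 1 ⟧)) (total (tail a)))) ⟨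
    sum (λ a → total (a ∷ tail a))
      ≲⟨ sum-mono-≼ (λ a → shortest (threePath a)
           (subst (λ b → IsPath _ a b (a ∷ a + x ∷ b ∷ [])) (endpoint a)
             (twoStepPath a x∈R y∈R (λ eq → 3≢0 (trans (sym x+y≡3) eq))))) ⟩
    sum (λ a → total (a ∷ a + x ∷ a + ⟦ 1 ⟧ + ⟦ 1 ⟧ + ⟦ 1 ⟧ ∷ []))
      ≈⟨ ≐-reflexive (sum-cong-≗ λ a → cong (λ b → total (a ∷ a + x ∷ b ∷ [])) (endpoint a)) ⟨
    sum (λ a → total (a ∷ a + x ∷ a + x + y ∷ []))         ≈⟨ sum-total₂ x y ⟩
    g x ⊕ g y                                              ∎
    where
    open ≼-Reasoning
    tail : 𝔽 → List 𝔽
    tail a = a + ⟦ 1 ⟧ ∷ a + ⟦ 1 ⟧ + ⟦ 1 ⟧ ∷ a + ⟦ 1 ⟧ + ⟦ 1 ⟧ + ⟦ 1 ⟧ ∷ []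
    endpoint : ∀ a → a + x + y ≡ a + ⟦ 1 ⟧ + ⟦ 1 ⟧ + ⟦ 1 ⟧
    endpoint a = trans (+-assoc a x y) (trans (cong (a +_) x+y≡3) (sym (a+1+1+1 a)))

  g1+g1≼g4 : g ⟦ 1 ⟧ ⊕ g ⟦ 1 ⟧ ≼ g ⟦ 4 ⟧
  g1+g1≼g4 = ⊕-cancelʳ-≼ (g ⟦ 1 ⟧) (begin
    (g ⟦ 1 ⟧ ⊕ g ⟦ 1 ⟧) ⊕ g ⟦ 1 ⟧  ≈⟨ ⊕-assoc (g ⟦ 1 ⟧) (g ⟦ 1 ⟧) (g ⟦ 1 ⟧) ⟩
    g ⟦ 1 ⟧ ⊕ (g ⟦ 1 ⟧ ⊕ g ⟦ 1 ⟧)  ≲⟨ three-step 4∈R (QR-neg -1∈R 1∈R) 4-1≡3 ⟩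
    g ⟦ 4 ⟧ ⊕ g (- ⟦ 1 ⟧)          ≲⟨ ⊕-mono-≼ ≼-refl (g-neg 1∈R) ⟩
    g ⟦ 4 ⟧ ⊕ g ⟦ 1 ⟧              ∎)
    where
    open ≼-Reasoning
    4-1≡3 : ⟦ 4 ⟧ - ⟦ 1 ⟧ ≡ ⟦ 3 ⟧
    4-1≡3 = trans (cong (_- ⟦ 1 ⟧) (sym (⟦+⟧ 1 3))) (xyx⁻¹≈y ⟦ 1 ⟧ ⟦ 3 ⟧)

  g1>0 : ¬ (g ⟦ 1 ⟧ ⊕ g ⟦ 1 ⟧ ≼ g ⟦ 1 ⟧)
  g1>0 2g≼g = sum-positive (λ a → w-pos (adjacent a 1∈R))
    (⊕-cancelʳ-≼ (g ⟦ 1 ⟧) (≼-trans 2g≼g (≐⇒≼ (≐-sym (⊕-identityˡ (g ⟦ 1 ⟧))))))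

  -- The subgroup generated by 4 and 6. Inverses appear as constructors that undo a multiplication,
  -- so `no-maximiser` can follow a derivation back to 1.
  data Smooth : Pred 𝔽 0ℓ where
    one : Smooth ⟦ 1 ⟧
    ×4  : ∀ {u} → Smooth u → Smooth (4 · u)
    ×6  : ∀ {u} → Smooth u → Smooth (6 · u)
    ÷4  : ∀ {u} → Smooth (4 · u) → Smooth u
    ÷6  : ∀ {u} → Smooth (6 · u) → Smooth u

  Smooth⇒QR : ∀ {u} → Smooth u → QR u
  Smooth⇒QR one    = 1∈R
  Smooth⇒QR (×4 s) = QR-* 4∈R (Smooth⇒QR s)
  Smooth⇒QR (×6 s) = QR-* 6∈R (Smooth⇒QR s)
  Smooth⇒QR (÷4 s) = QR-cancelˡ 4∈R (Smooth⇒QR s)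
  Smooth⇒QR (÷6 s) = QR-cancelˡ 6∈R (Smooth⇒QR s)

  Candidate : Pred 𝔽 0ℓ
  Candidate u = Smooth u × ¬ Exceptional u

  Maximiser : Pred 𝔽 0ℓ
  Maximiser u = Candidate u × ∀ v → Candidate v → g v ≼ g u

  1-candidate : Candidate ⟦ 1 ⟧
  1-candidate = one , λ exc → distinct-± 2 1 1≢0 5≢0 (±-join exc (inj₁ (⟦*⟧ 2 1)))

  4-candidate : Candidate ⟦ 4 ⟧
  4-candidate = subst Smooth (⟦*⟧ 4 1) (×4 one) ,
    λ exc → distinct-± 3 5 5≢0 11≢0 (±-join (inj₁ (⟦*⟧ 2 4)) exc)

  -- Since 4 is a candidate, a maximum at `±1` gives `2 g(1) ≤ g(4) ≤ g(1)`, against positivity.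
  ±1-not-maximiser : ∀ {u} → Maximiser u → ¬ (u ≡± ⟦ 1 ⟧)
  ±1-not-maximiser {u} (_ , max) u≡±1 = g1>0 (begin
    g ⟦ 1 ⟧ ⊕ g ⟦ 1 ⟧  ≲⟨ g1+g1≼g4 ⟩
    g ⟦ 4 ⟧            ≲⟨ max ⟦ 4 ⟧ 4-candidate ⟩
    g u                ≲⟨ gu≼g1 u≡±1 ⟩
    g ⟦ 1 ⟧            ∎)
    where
    open ≼-Reasoning
    gu≼g1 : u ≡± ⟦ 1 ⟧ → g u ≼ g ⟦ 1 ⟧
    gu≼g1 (inj₁ refl) = ≼-refl
    gu≼g1 (inj₂ refl) = g-neg 1∈R

  -- The maximum principle for 2 g u ≤ g x + g y, where x - y = 2 u.
  spread : ∀ {u x y} → Maximiser u → Candidate x → Candidate y → x - y ≡ 2 · u →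
           Maximiser x × Maximiser y
  spread {u} {x} {y} ((u∈S , ¬exc) , max) x-cand y-cand x-y≡2u =
    (x-cand , λ v v-cand → ≼-trans (max v v-cand) gu≼gx) ,
    (y-cand , λ v v-cand → ≼-trans (max v v-cand) gu≼gy)
    where
    2gu≼ : g u ⊕ g u ≼ g x ⊕ g y
    2gu≼ = ≼-trans
      (two-step (Smooth⇒QR u∈S) ¬exc (Smooth⇒QR (proj₁ x-cand)) (QR-neg -1∈R (Smooth⇒QR (proj₁ y-cand))) x-y≡2u)
      (⊕-mono-≼ ≼-refl (g-neg (Smooth⇒QR (proj₁ y-cand))))
    gu≼gx : g u ≼ g x
    gu≼gx = ⊕-cancelʳ-≼ (g u) (≼-trans 2gu≼ (⊕-mono-≼ ≼-refl (max y y-cand)))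
    gu≼gy : g u ≼ g y
    gu≼gy = ⊕-cancelʳ-≼ (g u) (≼-trans 2gu≼ (≼-trans (⊕-mono-≼ (max x x-cand) ≼-refl) (≐⇒≼ (⊕-comm (g u) (g y)))))

  ·-sub : ∀ m n x → (m ℕ.+ n) · x - m · x ≡ n · x
  ·-sub m n x = trans (cong (_- m · x) (sym (·-distrib m n x))) (xyx⁻¹≈y (m · x) (n · x))

  third : ∀ u → ∃ λ v → 3 · v ≡ u
  third u with i , i3≡1 ← inverse 3≢0 = i * u ,
    trans (sym (*-assoc ⟦ 3 ⟧ i u)) (trans (cong (_* u) (trans (*-comm ⟦ 3 ⟧ i) i3≡1)) (*-identityˡ u))

  cancel-3-± : ∀ m {v} → (3 ℕ.* m) · v ≡± ⟦ 3 ⟧ → m · v ≡± ⟦ 1 ⟧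
  cancel-3-± m {v} (inj₁ eq) = inj₁ (*-cancelˡ 3≢0 (trans (·-assoc 3 m v) (trans eq (sym (⟦*⟧ 3 1)))))
  cancel-3-± m {v} (inj₂ eq) = inj₂ (*-cancelˡ 3≢0 (begin
    3 · (m · v)      ≡⟨ ·-assoc 3 m v ⟩
    (3 ℕ.* m) · v    ≡⟨ eq ⟩
    - ⟦ 3 ⟧          ≡⟨ -1*x≈-x ⟦ 3 ⟧ ⟨
    - ⟦ 1 ⟧ * ⟦ 3 ⟧  ≡⟨ *-comm (- ⟦ 1 ⟧) ⟦ 3 ⟧ ⟩
    3 · (- ⟦ 1 ⟧)    ∎))
    where open ≡-Reasoning

  -- With v = u / 3, the relation 6 v = 8 v - 2 v.
  spread-thirds : ∀ {u} v → Maximiser u → 3 · v ≡ u →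
                  ¬ (4 · v ≡± ⟦ 3 ⟧) → ¬ (16 · v ≡± ⟦ 3 ⟧) →
                  Maximiser (8 · v) × Maximiser (2 · v)
  spread-thirds {u} v max@((u∈S , _) , _) 3v≡u 4v≢±3 16v≢±3 = spread max
    (subst Smooth (·-assoc 4 2 v) (×4 2v∈S) , 16v≢±3 ∘ exceptional-· 8)
    (2v∈S , 4v≢±3 ∘ exceptional-· 2)
    (begin
      8 · v - 2 · v  ≡⟨ ·-sub 2 6 v ⟩
      6 · v          ≡⟨ ·-assoc 2 3 v ⟨
      2 · (3 · v)    ≡⟨ cong (2 ·_) 3v≡u ⟩
      2 · u          ∎)
    where
    open ≡-Reasoning
    -- `2v` is `4u / 6`.
    2v∈S : Smooth (2 · v)
    2v∈S = ÷6 (subst Smooth (begin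
      4 · u          ≡⟨ cong (4 ·_) 3v≡u ⟨
      4 · (3 · v)    ≡⟨ ·-assoc 4 3 v ⟩
      12 · v         ≡⟨ ·-assoc 6 2 v ⟨
      6 · (2 · v)    ∎) (×4 u∈S))

  spread-4-6 : ∀ {u} → Maximiser u → ¬ Exceptional (6 · u) → ¬ Exceptional (4 · u) →
               Maximiser (6 · u) × Maximiser (4 · u)
  spread-4-6 {u} max@((u∈S , _) , _) ¬exc₆ ¬exc₄ =
    spread max (×6 u∈S , ¬exc₆) (×4 u∈S , ¬exc₄) (·-sub 4 2 u)

  scale-3-± : ∀ m {u} v → 3 · v ≡ u → m · u ≡± ⟦ 3 ⟧ → (m ℕ.* 3) · v ≡± ⟦ 3 ⟧
  scale-3-± m v refl = subst (_≡± ⟦ 3 ⟧) (·-assoc m 3 v)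

  -- If `8u = ±3` and `u = 3v`, then `8v = ±1`, yet `spread-thirds` makes `8v` a maximiser. Its side
  -- conditions could fail only if `6 = ±1` or `3 = ±2`.
  ¬exceptional-4 : ∀ {u} → Maximiser u → ¬ Exceptional (4 · u)
  ¬exceptional-4 {u} max exc with v , 3v≡u ← third u =
    ±1-not-maximiser (proj₁ (spread-thirds v max 3v≡u
      (λ 4v → distinct-± 1 5 5≢0 7≢0 (combine-± 2 1 v refl 4v 8v≡±1))
      (λ 16v → distinct-± 2 1 1≢0 5≢0 (combine-± 1 2 v refl 16v 8v≡±1)))) 8v≡±1
    where
    8v≡±1 : 8 · v ≡± ⟦ 1 ⟧
    8v≡±1 = cancel-3-± 8 (scale-3-± 8 v 3v≡u (exceptional-· 4 exc))

  -- If `12u = ±3` and `u = 3v`, then `12v = ±1`. Two spreads lead there: from `u` to `2v` by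
  -- thirds, then from `2v` to `6 · 2v`. The side conditions exclude `9 = ±1`, `9 = ±4` and
  -- `3 = ±2`.
  ¬exceptional-6 : ∀ {u} → Maximiser u → ¬ Exceptional (6 · u)
  ¬exceptional-6 {u} max exc with v , 3v≡u ← third u =
    ±1-not-maximiser (proj₁ (spread-4-6 max-2v
      (λ 24v → distinct-± 2 1 1≢0 5≢0 (combine-± 1 2 v refl (exceptional-·· 6 2 v 24v) 12v≡±1))
      (λ 16v → 16v≢±3 (exceptional-·· 4 2 v 16v))))
      (subst (_≡± ⟦ 1 ⟧) (sym (·-assoc 6 2 v)) 12v≡±1)
    where
    exceptional-·· : ∀ m n v → Exceptional (m · (n · v)) → (2 ℕ.* (m ℕ.* n)) · v ≡± ⟦ 3 ⟧
    exceptional-·· m n v exc = exceptional-· (m ℕ.* n) (subst Exceptional (·-assoc m n v) exc)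
    12v≡±1 : 12 · v ≡± ⟦ 1 ⟧
    12v≡±1 = cancel-3-± 12 (scale-3-± 12 v 3v≡u (exceptional-· 6 exc))
    16v≢±3 : ¬ (16 · v ≡± ⟦ 3 ⟧)
    16v≢±3 16v = distinct-± 4 5 5≢0 13≢0 (combine-± 3 4 v refl 16v 12v≡±1)
    max-2v : Maximiser (2 · v)
    max-2v = proj₂ (spread-thirds v max 3v≡u
      (λ 4v → distinct-± 1 8 (2≢0 ⊗ 2≢0 ⊗ 2≢0) (2≢0 ⊗ 5≢0) (combine-± 3 1 v refl 4v 12v≡±1))
      16v≢±3)

  max-×4 : ∀ {u} → Maximiser u → Maximiser (4 · u)
  max-×4 max = proj₂ (spread-4-6 max (¬exceptional-6 max) (¬exceptional-4 max))

  max-×6 : ∀ {u} → Maximiser u → Maximiser (6 · u)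
  max-×6 max = proj₁ (spread-4-6 max (¬exceptional-6 max) (¬exceptional-4 max))

  -- Carries the maximiser along the derivation of `Smooth u` to 1. Undoing a multiplication relies
  -- on `closed-under-inverse`.
  no-maximiser : ∀ {u} → Smooth u → ¬ Maximiser u
  no-maximiser one    max = ±1-not-maximiser max (inj₁ refl)
  no-maximiser (×4 s) max = no-maximiser s (closed-under-inverse (*-cancelˡ (proj₁ 4∈R)) Maximiser max-×4 max)
  no-maximiser (×6 s) max = no-maximiser s (closed-under-inverse (*-cancelˡ (proj₁ 6∈R)) Maximiser max-×6 max)
  no-maximiser (÷4 s) max = no-maximiser s (max-×4 max)
  no-maximiser (÷6 s) max = no-maximiser s (max-×6 max)

  absurd : ⊥
  absurd = maximum Candidate g λ where
    (inj₁ none)                      → none ⟦ 1 ⟧ 1-candidate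
    (inj₂ (u , u-cand@(u∈S , _) , max)) → no-maximiser u∈S (u-cand , max)

theorem1 : (p : ℕ) .{{_ : NonZero p}} →
    let open Residues p
        open Paley p
    in (p-prime : Prime p) → p > 5 →
       (-1∈R : QR (- ⟦ 1 ⟧)) (2∈N : QNR ⟦ 2 ⟧) (3∈N : QNR ⟦ 3 ⟧) →
       Irreducible (paleySystem p-prime -1∈R 2∈N 3∈N) ×
       ¬ Metrizable (paleySystem p-prime -1∈R 2∈N 3∈N)
theorem1 p p-prime p>5 -1∈R 2∈N 3∈N =
  Irreducibility.irreducible p p-prime p>5 -1∈R 2∈N 3∈N ,
  NonMetrizability.absurd p p-prime p>5 -1∈R 2∈N 3∈N
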